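{- Let $k \geq 2$ be a natural number and let $G$ be a finite bipartite graph of average degree at least $4k$ and girth $g$. Then there exist cycles of $(g/2 - 1)k$ consecutive even lengths in $G$, i.e. there is an even integer $\ell$ such that $G$ contains a cycle of length $\ell + 2i$ for every $i = 0, 1, \ldots, (g/2-1)k - 1$. Moreover, the shortest of these cycles (of length $\ell$) has length at most twice the radius of $G$.
   Context: The average degree of a graph $G$ is $2|E(G)|/|V(G)|$. The girth of $G$ is the length of a shortest cycle in $G$. The radius of a connected graph is $\min_{v}\max_{u} d(u,v)$, where $d$ is the graph distance. -}

module Defs where

open import Data.Nat using (ℕ; zero; suc; _+_; _*_; _≤_; _<ᵇ_)
open import Data.Bool using (Bool; T; _∧_)
open import Data.Fin using (Fin; toℕ)
open import Data.List using (List; []; _∷_; _++_; [_]; length; filterᵇ; allFin; cartesianProduct)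
open import Data.List.Relation.Unary.Linked using (Linked)
open import Data.List.Relation.Unary.Unique.Propositional using (Unique)
open import Data.Product using (Σ; _×_; _,_; ∃)
open import Relation.Binary.PropositionalEquality using (_≡_; _≢_)

record Graph : Set where
  field
    n      : ℕ
    adj    : Fin n → Fin n → Bool
    sym    : ∀ u v → adj u v ≡ adj v u
    irrefl : ∀ v → adj v v ≡ Data.Bool.false

open Graph public

Adj : (G : Graph) → Fin (n G) → Fin (n G) → Set
Adj G u v = T (adj G u v)

numEdges : Graph → ℕ
numEdges G = length (filterᵇ (λ p → (toℕ (Data.Product.proj₁ p) <ᵇ toℕ (Data.Product.proj₂ p))
                                      ∧ adj G (Data.Product.proj₁ p) (Data.Product.proj₂ p))
                             (cartesianProduct (allFin (n G)) (allFin (n G))))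

-- Average degree 2|E|/|V| is at least d  (for |V| ≥ 1), i.e. 2|E| ≥ d |V|.
AvgDegreeAtLeast : Graph → ℕ → Set
AvgDegreeAtLeast G d = 1 ≤ n G × d * n G ≤ 2 * numEdges G

Bipartite : Graph → Set
Bipartite G = Σ (Fin (n G) → Bool) λ c → ∀ u v → Adj G u v → c u ≢ c v

HasCycle : (G : Graph) → ℕ → Set
HasCycle G L = 3 ≤ L × Σ (Fin (n G)) λ v → Σ (List (Fin (n G))) λ vs →
  length (v ∷ vs) ≡ L × Unique (v ∷ vs) × Linked (Adj G) ((v ∷ vs) ++ [ v ])

Girth : Graph → ℕ → Set
Girth G g = HasCycle G g × (∀ L → HasCycle G L → g ≤ L)

data Walk (G : Graph) : Fin (n G) → Fin (n G) → ℕ → Set where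
  here : ∀ {v} → Walk G v v 0
  step : ∀ {u w v m} → Adj G u w → Walk G w v m → Walk G u v (suc m)

DistAtMost : (G : Graph) → Fin (n G) → Fin (n G) → ℕ → Set
DistAtMost G u v r = Σ ℕ λ m → m ≤ r × Walk G u v m

RadiusAtMost : Graph → ℕ → Set
RadiusAtMost G r = Σ (Fin (n G)) λ v → ∀ u → DistAtMost G u v r

{-# OPTIONS --safe #-}
-- Root every component of G, at a centre if G is connected.  Edges join consecutive levels, so splitting each vertex
-- into its upward and its downward half gives a graph on 2|V| vertices and |E| ≥ 2k|V| edges, each component of which
-- lies between two levels i and i + 1.  Peeling off vertices of degree at most k leaves minimum degree k + 1; the end of
-- a maximal path has all its neighbours on the path, and by the girth they are g - 2 apart, which gives a cycle with a
-- chord on N > k(g - 2) + 1 vertices.  Let h be the height at which the ancestors of its level-i vertices first merge,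
-- and 2-colour these vertices by whether their ancestor at height h - 1 is a fixed one.  A cycle with a chord contains paths of every
-- length below N with differently coloured ends, unless the colouring has period 2 along the cycle.  Closing
-- such a path of length 2m through the common ancestor yields a cycle of length 2m + 2h, where h ≤ i.
module Submission where

open import Defs hiding (sym)
open import Data.Bool using (Bool; true; false; T; not; _∧_)
import Data.Bool.Properties as Bool
open import Data.Empty using (⊥; ⊥-elim)
open import Data.Fin using (Fin; toℕ)
import Data.Fin.Properties as Fin
open import Data.List using (List; []; _∷_; _++_; [_]; length; map; reverse; filterᵇ; cartesianProduct; allFin)
import Data.List.Membership.DecPropositional as DecMembership
open import Data.List.Membership.Propositional using (_∈_; find; lose)
open import Data.List.Membership.Propositional.Properties using (∈-∃++; ∈-allFin; ∈-map⁻; ∈-filter⁺; ∈-filter⁻)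
import Data.List.Properties as List
open import Data.List.Relation.Binary.Permutation.Propositional using (_↭_; ↭-sym; ↭⇒↭ₛ)
open import Data.List.Relation.Binary.Permutation.Propositional.Properties using (↭-reverse; shift; ∈-resp-↭; All-resp-↭; ↭-length) renaming (map⁺ to ↭-map⁺)
import Data.List.Relation.Binary.Permutation.Setoid.Properties as Permutationₛ
open import Data.List.Relation.Binary.Sublist.Propositional using (_⊆_; []; _∷_; _∷ʳ_; ⊆-refl; minimum)
open import Data.List.Relation.Binary.Sublist.Propositional.Properties using (All-resp-⊆; ++⁺; ++⁺ˡ)
open import Data.List.Relation.Unary.All as All using (All; []; _∷_)
import Data.List.Relation.Unary.All.Properties as All
open import Data.List.Relation.Unary.AllPairs using ([]; _∷_)
open import Data.List.Relation.Unary.Any as Any using (here; there)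
open import Data.List.Relation.Unary.Linked using (Linked; []; [-]; _∷_)
open import Data.List.Relation.Unary.Unique.Propositional using (Unique)
import Data.List.Relation.Unary.Unique.Propositional.Properties as Unique
open import Data.Nat using (ℕ; zero; suc; _+_; _*_; _∸_; _/_; _%_; _≤_; _<_; z≤n; s≤s; s≤s⁻¹; _≟_; _≤?_; _<?_; _≡ᵇ_; _<ᵇ_)
open import Data.Nat.DivMod
open import Data.Nat.ListAction using (sum)
open import Data.Nat.ListAction.Properties using (sum-++; sum-↭)
open import Data.Nat.Properties
open import Data.Nat.Tactic.RingSolver using (solve-∀)
open import Data.Product using (Σ; Σ-syntax; ∃; _×_; _,_; proj₁; proj₂)
import Data.Product.Properties as Product
open import Data.Sum using (_⊎_; inj₁; inj₂; [_,_]′)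
open import Data.Unit using (⊤)
open import Function using (_∘_; id; const)
open import Relation.Binary.Definitions using (DecidableEquality; tri<; tri≈; tri>)
open import Relation.Binary.PropositionalEquality using (_≡_; _≢_; refl; sym; trans; cong; cong₂; subst; subst₂; setoid; module ≡-Reasoning)
open import Relation.Nullary using (¬_; Dec; yes; no; does)
open import Relation.Nullary.Decidable using (T?; ¬?; map′; _×-dec_; _→-dec_; dec-true; dec-false)

-- Paths

unique-resp-↭ : {A : Set} {xs ys : List A} → xs ↭ ys → Unique xs → Unique ys
unique-resp-↭ {A} p = Permutationₛ.Unique-resp-↭ (setoid A) (↭⇒↭ₛ p)

unique-⊆-length : {A : Set} {xs ys : List A} → Unique xs → (∀ {x} → x ∈ xs → x ∈ ys) →
                  length xs ≤ length ys
unique-⊆-length {xs = []}     _         _   = z≤n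
unique-⊆-length {xs = x ∷ xs} (x∉ ∷ u) sub with ∈-∃++ (sub (here refl))
... | as , bs , refl =
  subst (suc (length xs) ≤_) (sym (↭-length (shift x as bs)))
    (s≤s (unique-⊆-length u λ y∈ → strip (All.lookup x∉ y∈) (∈-resp-↭ (shift x as bs) (sub (there y∈)))))
  where
  strip : ∀ {y} → x ≢ y → y ∈ x ∷ as ++ bs → y ∈ as ++ bs
  strip x≢y (here refl) = ⊥-elim (x≢y refl)
  strip x≢y (there y∈) = y∈

-- Both ends are indices next to the vertex list, which lets routes be concatenated and reversed
-- without recomputing first and last entries.
data Route {A : Set} (R : A → A → Set) : A → List A → A → Set where
  [·] : ∀ {x} → Route R x (x ∷ []) x
  _∷_ : ∀ {x y z ys} → R x y → Route R y ys z → Route R x (x ∷ ys) z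

module _ {A : Set} {R : A → A → Set} where

  route-++ : ∀ {x y y′ z xs ys} → Route R x xs y → R y y′ → Route R y′ ys z → Route R x (xs ++ ys) z
  route-++ [·]      e q = e ∷ q
  route-++ (f ∷ p) e q = f ∷ route-++ p e q

  route-reverse : (∀ {x y} → R x y → R y x) → ∀ {x y xs} → Route R x xs y → Route R y (reverse xs) x
  route-reverse R-sym [·] = [·]
  route-reverse R-sym {x} {y} (_∷_ {ys = ys} f p) =
    subst (λ l → Route R y l x) (sym (List.unfold-reverse x ys))
      (route-++ (route-reverse R-sym p) (R-sym f) [·])

  route-closed : ∀ {x y v xs} → Route R x xs y → R y v → Linked R (xs ++ [ v ])
  route-closed [·]                       e = e ∷ [-]
  route-closed (f ∷ [·])                 e = f ∷ route-closed [·] e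
  route-closed (f ∷ p@(_ ∷ _)) e = f ∷ route-closed p e

  last∈ : ∀ {x y xs} → Route R x xs y → y ∈ xs
  last∈ [·]     = here refl
  last∈ (f ∷ p) = there (last∈ p)

  head∈ : ∀ {x y xs} → Route R x xs y → x ∈ xs
  head∈ [·]     = here refl
  head∈ (_ ∷ _) = here refl

route-map : {A B : Set} {R : A → A → Set} {Q : B → B → Set} (f : A → B) {P : A → Set} →
            (∀ {x y} → P x → P y → R x y → Q (f x) (f y)) →
            ∀ {x y xs} → All P xs → Route R x xs y → Route Q (f x) (map f xs) (f y)
route-map f h _         [·]     = [·]
route-map f h (px ∷ ps) (e ∷ p) = h px (All.lookup ps (head∈ p)) e ∷ route-map f h ps p

unique-map : {A B : Set} (f : A → B) {P : A → Set} → (∀ {x y} → P x → P y → f x ≡ f y → x ≡ y) →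
             ∀ {xs} → All P xs → Unique xs → Unique (map f xs)
unique-map f inj []        []       = []
unique-map f inj (px ∷ ps) (x∉ ∷ u) =
  All.map⁺ (All.zipWith (λ { (x≢y , py) fx≡fy → x≢y (inj px py fx≡fy) }) (x∉ , ps)) ∷ unique-map f inj ps u

-- The length ℓ counts edges. `P` confines the vertices: two paths join to a path as soon as their
-- confining predicates exclude each other, so disjointness is never checked on vertex lists.
record Path {A : Set} (R : A → A → Set) (P : A → Set) (x y : A) (ℓ : ℕ) : Set where
  constructor path
  field
    vertices : List A
    route    : Route R x vertices y
    unique   : Unique vertices
    inside   : All P vertices
    len      : length vertices ≡ suc ℓ

module _ {A : Set} {R : A → A → Set} where

  trivial : {P : A → Set} (x : A) → P x → Path R P x x 0
  trivial x px = path (x ∷ []) [·] ([] ∷ []) (px ∷ []) refl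

  join : ∀ {P Q W : A → Set} {x y y′ z k ℓ} → Path R P x y k → R y y′ → Path R Q y′ z ℓ →
         (∀ {v} → P v → Q v → ⊥) → (∀ {v} → P v → W v) → (∀ {v} → Q v → W v) →
         Path R W x z (suc (k + ℓ))
  join {k = k} {ℓ} (path xs p u as m) e (path ys q v bs n) disjoint P⊆W Q⊆W =
    path (xs ++ ys) (route-++ p e q)
      (Unique.++⁺ u v λ { (x∈ , y∈) → disjoint (All.lookup as x∈) (All.lookup bs y∈) })
      (All.++⁺ (All.map P⊆W as) (All.map Q⊆W bs))
      (trans (List.length-++ xs) (trans (cong₂ _+_ m n) (cong suc (+-suc k ℓ))))

  relax : ∀ {P Q : A → Set} {x y ℓ} → (∀ {v} → P v → Q v) → Path R P x y ℓ → Path R Q x y ℓ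
  relax P⊆Q (path xs p u as m) = path xs p u (All.map P⊆Q as) m

  backwards : (∀ {x y} → R x y → R y x) → ∀ {P x y ℓ} → Path R P x y ℓ → Path R P y x ℓ
  backwards R-sym (path xs p u as m) =
    path (reverse xs) (route-reverse R-sym p) (unique-resp-↭ (↭-sym (↭-reverse xs)) u)
      (All-resp-↭ (↭-sym (↭-reverse xs)) as) (trans (List.length-reverse xs) m)

least : {P : ℕ → Set} → (∀ m → Dec (P m)) → ∀ m → P m →
        Σ[ t ∈ ℕ ] P t × t ≤ m × (∀ {s} → s < t → ¬ P s)
least P? zero    p = 0 , p , z≤n , λ ()
least {P} P? (suc m) p with P? 0
... | yes p₀ = 0 , p₀ , z≤n , λ ()
... | no ¬p₀ with least (P? ∘ suc) m p
...   | t , pt , t≤m , min = suc t , pt , s≤s t≤m , below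
  where
  below : ∀ {s} → s < suc t → ¬ P s
  below {zero}  _         = ¬p₀
  below {suc s} (s≤s s<t) = min s<t

-- Cycles with a chord

-- Early exit: `inj₁` carries an object that ends the search. Below it is always a path with
-- differently coloured ends, and `inj₂` is what its absence forces.
bind : {A B C : Set} → A ⊎ B → (B → A ⊎ C) → A ⊎ C
bind (inj₁ a) _ = inj₁ a
bind (inj₂ b) k = k b

collect : {A : Set} {P : ℕ → Set} (m : ℕ) → (∀ t → t < m → A ⊎ P t) → A ⊎ (∀ t → t < m → P t)
collect zero    f = inj₂ λ _ ()
collect {P = P} (suc m) f =
  bind (collect m λ t t<m → f t (m<n⇒m<1+n t<m)) λ below →
  bind (f m ≤-refl) λ at → inj₂ λ t t<1+m → extend below at t (m≤n⇒m<n∨m≡n (s≤s⁻¹ t<1+m))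
  where
  extend : (∀ t → t < m → P t) → P m → ∀ t → t < m ⊎ t ≡ m → P t
  extend below at t (inj₁ t<m) = below t t<m
  extend below at t (inj₂ refl) = at

-- Reduces a linear inequality to a ring identity: `s ≤ t` is a sum of known inequalities and `k`
-- the slack.
≤-by : ∀ {a b s t} k → s ≤ t → a + t + k ≡ b + s → a ≤ b
≤-by {a} {b} {s} {t} k s≤t eq =
  +-cancelʳ-≤ t a b (≤-trans (m≤m+n (a + t) k) (≤-trans (≤-reflexive eq) (+-monoʳ-≤ b s≤t)))

difference : ∀ {m n} → m ≤ n → Σ[ k ∈ ℕ ] m + k ≡ n
difference m≤n = m≤n⇒∃[o]m+o≡n m≤n

Periodic : ℕ → (ℕ → Bool) → Set
Periodic p f = ∀ x → f (x + p) ≡ f x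

periodic-* : ∀ {p f} → Periodic p f → ∀ x q → f (x + p * q) ≡ f x
periodic-* {p} {f} per x zero    = cong f (trans (cong (x +_) (*-zeroʳ p)) (+-identityʳ x))
periodic-* {p} {f} per x (suc q) =
  trans (cong f (shuffle x p q)) (trans (periodic-* {p} {f} per (x + p) q) (per x))
  where
  shuffle : ∀ x p q → x + p * suc q ≡ x + p + p * q
  shuffle = solve-∀

periodic-complement : ∀ {m p q f} → Periodic m f → Periodic p f → p + q ≡ m → Periodic q f
periodic-complement {m} {p} {q} {f} perₘ perₚ refl x =
  trans (sym (perₚ (x + q))) (trans (cong f (shuffle x p q)) (perₘ x))
  where
  shuffle : ∀ x p q → x + q + p ≡ x + (p + q)
  shuffle = solve-∀

-- The point of the block congruent to x modulo d has offset (x + d′ * s) % d, because d′ ≡ -1 (mod d).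
block : ∀ {d′ F G} s → Periodic (suc d′) F → Periodic (suc d′) G →
        (∀ t → t < suc d′ → F (s + t) ≡ G (s + t)) → ∀ x → F x ≡ G x
block {d′} {F} {G} s perF perG h x =
  trans (transport perF) (trans (h t (m%n<n y d)) (sym (transport perG)))
  where
  d = suc d′
  y = x + d′ * s
  t = y % d
  same : s + t + d * (y / d) ≡ x + d * s
  same = trans (trans (+-assoc s t _) (cong (s +_) (trans (cong (t +_) (*-comm d (y / d))) (sym (m≡m%n+[m/n]*n y d)))))
               (rearrange s x d′)
    where
    rearrange : ∀ s x d′ → s + (x + d′ * s) ≡ x + suc d′ * s
    rearrange = solve-∀
  transport : ∀ {H} → Periodic d H → H x ≡ H (s + t)
  transport {H} per =
    trans (sym (periodic-* {f = H} per x s)) (trans (sym (cong H same)) (periodic-* {f = H} per (s + t) (y / d)))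

-- The cycle 0, 1, ..., `N′` with a chord from 0 to `suc r′`; the two bounds on `r′` say that the
-- chord is not an edge of the cycle. The colouring `χ` is extended below to the function `w` of
-- period N.
module Theta
  (E : ℕ → ℕ → Set) (E-sym : ∀ {i j} → E i j → E j i) (N′ r′ : ℕ)
  (E-suc : ∀ {i} → suc i < suc N′ → E i (suc i)) (E-close : E N′ 0)
  (E-chord : E 0 (suc r′)) (1≤r′ : 1 ≤ r′) (chord-inner : suc (suc r′) < suc N′) (χ : ℕ → Bool) where

  N r : ℕ
  N = suc N′
  r = suc r′

  w : ℕ → Bool
  w x = χ (x % N)

  w≡χ : ∀ {x} → x < N → w x ≡ χ x
  w≡χ x<N = cong χ (m<n⇒m%n≡m x<N)

  w-periodic : Periodic N w
  w-periodic x = cong χ ([m+n]%n≡m%n x N)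

  Split : ℕ → Set
  Split ℓ = Σ[ a ∈ ℕ ] Σ[ b ∈ ℕ ] Path E (_< N) a b ℓ × χ a ≢ χ b

  test : ∀ {a b ℓ} → Path E (_< N) a b ℓ → Split ℓ ⊎ χ a ≡ χ b
  test {a} {b} p with χ a Bool.≟ χ b
  ... | yes eq = inj₂ eq
  ... | no neq = inj₁ (a , b , p , neq)

  up : ∀ l {a b} → a + l ≡ b → b < N → Path E (λ v → a ≤ v × v ≤ b) a b l
  up zero    {a} eq _ with refl ← trans (sym (+-identityʳ a)) eq = trivial a (≤-refl , ≤-refl)
  up (suc l) {a} {b} eq b<N =
    join (trivial {P = _≡ a} a refl) (E-suc (≤-<-trans a<b b<N)) (up l (trans (sym (+-suc a l)) eq) b<N)
      (λ { refl (a<a , _) → <-irrefl refl a<a })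
      (λ { refl → ≤-refl , <⇒≤ a<b })
      (λ { (a<v , v≤b) → <⇒≤ a<v , v≤b })
    where
    a<b : a < b
    a<b = subst (a <_) eq (m<m+n a (s≤s z≤n))

  down : ∀ l {a b} → a + l ≡ b → b < N → Path E (λ v → a ≤ v × v ≤ b) b a l
  down l eq b<N = backwards E-sym (up l eq b<N)

  into-zero : ∀ x j → x + j ≡ N → 1 ≤ x →
              Σ[ a ∈ ℕ ] w x ≡ χ a × Path E (λ v → (v ≡ 0 ⊎ x ≤ v) × v < N) a 0 j
  into-zero x zero eq 1≤x with refl ← trans (sym (+-identityʳ x)) eq =
    0 , w-periodic 0 , trivial 0 (inj₁ refl , s≤s z≤n)
  into-zero x (suc j) eq 1≤x =
    x , w≡χ (≤-<-trans x≤N′ ≤-refl) ,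
    subst (Path E _ x 0) (cong suc (+-identityʳ j))
      (join (up j x+j≡N′ ≤-refl) E-close (trivial {P = _≡ 0} 0 refl)
        (λ { (x≤0 , _) refl → <-irrefl refl (≤-trans 1≤x x≤0) })
        (λ { (x≤v , v≤N′) → inj₂ x≤v , s≤s v≤N′ })
        (λ { refl → inj₁ refl , s≤s z≤n }))
    where
    x+j≡N′ : x + j ≡ N′
    x+j≡N′ = suc-injective (trans (sym (+-suc x j)) eq)
    x≤N′ : x ≤ N′
    x≤N′ = subst (x ≤_) x+j≡N′ (m≤m+n x j)

  -- The witness is the arc of ℓ edges that starts at j, led through the closing edge when j + ℓ
  -- reaches N.
  arc : ∀ ℓ → 1 ≤ ℓ → ℓ < N → ∀ j → j < N → Split ℓ ⊎ w j ≡ w (j + ℓ)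
  arc ℓ 1≤ℓ ℓ<N j j<N with j + ℓ <? N
  ... | yes inside =
    bind (test (relax (λ { (_ , v≤b) → ≤-<-trans v≤b inside }) (up ℓ refl inside))) λ eq →
    inj₂ (trans (w≡χ j<N) (trans eq (sym (w≡χ inside))))
  ... | no ¬inside with difference (≮⇒≥ ¬inside) | difference j<N
  ...   | b , N+b≡j+ℓ | m , j+m≡N′ =
    bind (test (subst (Path E _ j b) len
           (join (up m (suc-injective j+m≡N′) ≤-refl) E-close (up b {0} refl (<-trans b<j j<N))
             (λ { (j≤v , _) (_ , v≤b) → <-irrefl refl (≤-<-trans (≤-trans j≤v v≤b) b<j) })
             (λ { (_ , v≤N′) → s≤s v≤N′ })
             (λ { (_ , v≤b) → ≤-<-trans v≤b (<-trans b<j j<N) })))) λ eq →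
    inj₂ (trans (w≡χ j<N) (trans eq (trans (sym (w≡χ (<-trans b<j j<N)))
           (trans (sym (w-periodic b)) (cong w (trans (+-comm b N) N+b≡j+ℓ))))))
    where
    b<j : b < j
    b<j = +-cancelˡ-< N b j (subst₂ _<_ (sym N+b≡j+ℓ) (+-comm j N) (+-monoʳ-< j ℓ<N))
    len : suc (m + b) ≡ ℓ
    len = +-cancelˡ-≡ j _ _ (trans (shuffle j m b) (trans (cong (_+ b) j+m≡N′) N+b≡j+ℓ))
      where
      shuffle : ∀ j m b → j + suc (m + b) ≡ suc (j + m) + b
      shuffle = solve-∀

  -- The four ways of running through the chord 0 — r: the cycle is entered at 0 from either side and left from r on either side.
  below-chord-above : ∀ {j f} → j < r → r + f < N → Split (suc (j + f)) ⊎ w j ≡ w (r + f)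
  below-chord-above {j} {f} j<r e<N =
    bind (test (join (down j {0} refl j<N) E-chord (up f refl e<N)
      (λ { (_ , v≤j) (r≤v , _) → <-irrefl refl (<-≤-trans (≤-<-trans v≤j j<r) r≤v) })
      (λ { (_ , v≤j) → ≤-<-trans v≤j j<N })
      (λ { (_ , v≤e) → ≤-<-trans v≤e e<N }))) λ eq →
    inj₂ (trans (w≡χ j<N) (trans eq (sym (w≡χ e<N))))
    where
    j<N : j < N
    j<N = <-trans j<r (≤-<-trans (m≤m+n r f) e<N)

  below-chord-below : ∀ {j b f} → j < b → b + f ≡ r → Split (suc (j + f)) ⊎ w j ≡ w b
  below-chord-below {j} {b} {f} j<b b+f≡r =
    bind (test (join (down j {0} refl j<N) E-chord (down f b+f≡r r<N)
      (λ { (_ , v≤j) (b≤v , _) → <-irrefl refl (<-≤-trans (≤-<-trans v≤j j<b) b≤v) })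
      (λ { (_ , v≤j) → ≤-<-trans v≤j j<N })
      (λ { (_ , v≤r) → ≤-<-trans v≤r r<N }))) λ eq →
    inj₂ (trans (w≡χ j<N) (trans eq (sym (w≡χ b<N))))
    where
    r<N : r < N
    r<N = <⇒≤ chord-inner
    b<N : b < N
    b<N = ≤-<-trans (subst (b ≤_) b+f≡r (m≤m+n b f)) r<N
    j<N : j < N
    j<N = <-trans j<b b<N

  above-chord-above : ∀ {x j f} → x + j ≡ N → r + f < x → Split (suc (j + f)) ⊎ w x ≡ w (r + f)
  above-chord-above {x} {j} {f} x+j≡N e<x with into-zero x j x+j≡N (≤-<-trans z≤n e<x)
  ... | a , wx≡χa , p =
    bind (test (join p E-chord (up f refl e<N)
      (λ { (inj₁ refl , _) (() , _)
         ; (inj₂ x≤v , _) (_ , v≤e) → <-irrefl refl (≤-<-trans (≤-trans x≤v v≤e) e<x) })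
      proj₂
      (λ { (_ , v≤e) → ≤-<-trans v≤e e<N }))) λ eq →
    inj₂ (trans wx≡χa (trans eq (sym (w≡χ e<N))))
    where
    e<N : r + f < N
    e<N = <-≤-trans e<x (subst (x ≤_) x+j≡N (m≤m+n x j))

  above-chord-below : ∀ {x j b f} → x + j ≡ N → r < x → 1 ≤ b → b + f ≡ r → Split (suc (j + f)) ⊎ w x ≡ w b
  above-chord-below {x} {j} {b} {f} x+j≡N r<x 1≤b b+f≡r with into-zero x j x+j≡N (≤-<-trans z≤n r<x)
  ... | a , wx≡χa , p =
    bind (test (join p E-chord (down f b+f≡r r<N)
      (λ { (inj₁ refl , _) (b≤0 , _) → <-irrefl refl (≤-trans 1≤b b≤0)
         ; (inj₂ x≤v , _) (_ , v≤r) → <-irrefl refl (≤-<-trans (≤-trans x≤v v≤r) r<x) })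
      proj₂
      (λ { (_ , v≤r) → ≤-<-trans v≤r r<N }))) λ eq →
    inj₂ (trans wx≡χa (trans eq (sym (w≡χ b<N))))
    where
    r<N : r < N
    r<N = <⇒≤ chord-inner
    b<N : b < N
    b<N = ≤-<-trans (subst (b ≤_) b+f≡r (m≤m+n b f)) r<N

  -- Periods of the colouring

  TwoPeriodic : Set
  TwoPeriodic = Periodic 2 w

  -- If no arc of length ℓ is split, then ℓ is a period, hence so is N - ℓ, and both are at least the least period d.
  module Periods (d′ ℓ : ℕ) (d-periodic : Periodic (suc d′) w)
    (d-least : ∀ {p} → 1 ≤ p → Periodic p w → suc d′ ≤ p)
    (1≤ℓ : 1 ≤ ℓ) (ℓ<N : ℓ < N) (ℓ-periodic : Periodic ℓ w) where

    d : ℕ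
    d = suc d′

    d≤ℓ : d ≤ ℓ
    d≤ℓ = d-least 1≤ℓ ℓ-periodic

    ℓ+d≤N : ℓ + d ≤ N
    ℓ+d≤N with difference ℓ<N
    ... | m , ℓ+m≡N = subst (ℓ + d ≤_) (trans (+-suc ℓ m) ℓ+m≡N)
      (+-monoʳ-≤ ℓ (d-least (s≤s z≤n) (periodic-complement {q = suc m} {f = w} w-periodic ℓ-periodic (trans (+-suc ℓ m) ℓ+m≡N))))

    shift-periodic : ∀ c → Periodic d (λ x → w (x + c))
    shift-periodic c x = trans (cong w (eq x d c)) (d-periodic (x + c))
      where
      eq : ∀ x d c → x + d + c ≡ x + c + d
      eq = solve-∀

    -- Modulo d, the factor d′ is -1, so x ↦ c + d′ * x is the reflection x ↦ c - x.
    reflect-periodic : ∀ c → Periodic d (λ x → w (c + d′ * x))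
    reflect-periodic c x = trans (cong w (eq x d′ c)) (periodic-* {d} {w} d-periodic (c + d′ * x) d′)
      where
      eq : ∀ x d′ c → c + d′ * (x + suc d′) ≡ c + d′ * x + suc d′ * d′
      eq = solve-∀

    -- For t < d, the path from N - d + 1 + t up to 0, over the chord and up to r + t + ℓ - d has
    -- length ℓ. Modulo the periods N, ℓ and d its ends are t + 1 and r + t. If none of these paths
    -- is split, r - 1 is a positive period below d, which is absurd.
    near-above : r < d → Split ℓ ⊎ TwoPeriodic
    near-above r<d with difference d≤ℓ | difference ℓ+d≤N
    ... | c , d+c≡ℓ | k , ℓ+d+k≡N =
      bind (collect d hit) λ h →
      ⊥-elim (<-irrefl refl (<-≤-trans (<-trans ≤-refl r<d) (d-least 1≤r′ (r′-periodic h))))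
      where
      s : ℕ
      s = suc (ℓ + k)
      hit : ∀ t → t < d → Split ℓ ⊎ w (s + t) ≡ w (r + (t + c))
      hit t t<d with difference t<d
      ... | j , t+j≡d =
        subst (λ l → Split l ⊎ w (s + t) ≡ w (r + (t + c)))
          (trans (eq₁ j t c) (trans (cong (_+ c) t+j≡d) d+c≡ℓ))
          (above-chord-above
            (trans (eq₂ ℓ k t j) (trans (cong (λ u → ℓ + u + k) t+j≡d) ℓ+d+k≡N))
            (below r t c d k ℓ r<d d+c≡ℓ))
        where
        eq₁ : ∀ j t c → suc (j + (t + c)) ≡ suc (t + j) + c
        eq₁ = solve-∀
        eq₂ : ∀ ℓ k t j → suc (ℓ + k) + t + j ≡ ℓ + suc (t + j) + k
        eq₂ = solve-∀
        below : ∀ r t c d k ℓ → r < d → d + c ≡ ℓ → r + (t + c) < suc (ℓ + k) + t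
        below r t c d k _ r<d refl = ≤-by (suc k) r<d (eq r t c d k)
          where
          eq : ∀ r t c d k → suc (r + (t + c)) + d + suc k ≡ suc (d + c + k) + t + suc r
          eq = solve-∀
      r′-periodic : (∀ t → t < d → w (s + t) ≡ w (r + (t + c))) → Periodic r′ w
      r′-periodic h = block s (shift-periodic r′) d-periodic λ t t<d →
        trans (trans (sym (d-periodic (s + t + r′)))
          (trans (cong w (trans (eq₁ ℓ k t r′ d) (cong (suc r′ + t +_) ℓ+d+k≡N))) (w-periodic (r + t))))
        (sym (trans (h t t<d) (trans (sym (d-periodic (r + (t + c))))
          (trans (cong w (trans (eq₂ r t c d) (cong (r + t +_) d+c≡ℓ))) (ℓ-periodic (r + t))))))
        where
        eq₁ : ∀ ℓ k t r′ d → suc (ℓ + k) + t + r′ + d ≡ suc r′ + t + (ℓ + d + k)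
        eq₁ = solve-∀
        eq₂ : ∀ r t c d → r + (t + c) + d ≡ r + t + (d + c)
        eq₂ = solve-∀

    -- For t < d, the path from t down to 0, over the chord and down to r - ℓ + 1 + t has length ℓ.
    -- If none is split, r + 1 is a period, hence so is N - r - 1, which is positive and below d:
    -- absurd.
    near-below : N < r + d → Split ℓ ⊎ TwoPeriodic
    near-below N<r+d with difference d≤ℓ | difference ℓ+d≤N
    ... | c , d+c≡ℓ | k , ℓ+d+k≡N with difference (big r ℓ d k N N<r+d ℓ+d+k≡N) | difference chord-inner
      where
      big : ∀ r ℓ d k N → N < r + d → ℓ + d + k ≡ N → ℓ + k < r
      big r ℓ d k _ N<r+d refl = ≤-by 0 N<r+d (eq r ℓ d k)
        where
        eq : ∀ r ℓ d k → suc (ℓ + k) + (r + d) + 0 ≡ r + suc (ℓ + d + k)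
        eq = solve-∀
    ...   | v , ℓ+k+v≡r | q , r+q≡N =
      bind (collect d hit) λ h →
      ⊥-elim (<-irrefl refl (<-≤-trans q<d
        (d-least (s≤s z≤n) (periodic-complement {q = suc q} {f = w} w-periodic (r+1-periodic h) (trans (+-suc (suc r) q) r+q≡N)))))
      where
      q<d : suc q < d
      q<d = bound r q d N r+q≡N N<r+d
        where
        bound : ∀ r q d N → suc (suc r) + q ≡ N → N < r + d → suc q < d
        bound r q d _ refl N<r+d = ≤-by 1 N<r+d (eq r q d)
          where
          eq : ∀ r q d → suc (suc q) + (r + d) + 1 ≡ d + suc (suc (suc r) + q)
          eq = solve-∀
      hit : ∀ t → t < d → Split ℓ ⊎ w t ≡ w (suc (suc t) + k + v)
      hit t t<d with difference t<d
      ... | u , t+u≡d =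
        subst (λ l → Split l ⊎ w t ≡ w (suc (suc t) + k + v))
          (trans (eq₁ t u c) (trans (cong (_+ c) t+u≡d) d+c≡ℓ))
          (below-chord-below (≤-trans (m≤n+m (suc t) 1) (≤-trans (m≤m+n (suc (suc t)) k) (m≤m+n _ v)))
            (trans (eq₂ t k v u c) (trans (cong (λ y → suc (y + k) + v) (trans (cong (_+ c) t+u≡d) d+c≡ℓ)) ℓ+k+v≡r)))
        where
        eq₁ : ∀ t u c → suc (t + (u + c)) ≡ suc (t + u) + c
        eq₁ = solve-∀
        eq₂ : ∀ t k v u c → suc (suc t) + k + v + (u + c) ≡ suc (suc (t + u) + c + k) + v
        eq₂ = solve-∀
      r+1-periodic : (∀ t → t < d → w t ≡ w (suc (suc t) + k + v)) → Periodic (suc r) w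
      r+1-periodic h = block 0 (shift-periodic (suc r)) d-periodic λ t t<d →
        sym (trans (h t t<d) (trans (sym (ℓ-periodic (suc (suc t) + k + v))) (cong w (trans (eq t k v ℓ) (cong (λ y → t + suc y) ℓ+k+v≡r)))))
        where
        eq : ∀ t k v ℓ → suc (suc t) + k + v + ℓ ≡ t + suc (suc (ℓ + k) + v)
        eq = solve-∀

    -- For each x in the block s, ..., s + d - 1, the path goes up from x to 0, over the chord and
    -- down, for ℓ edges in all. Modulo the periods it ends at r + 1 - x. The four bounds give, in
    -- turn, r < x, room for the chord, x ≤ N, and an end above 0; one block covers all residues
    -- modulo d.
    reflection-above : ∀ s → r < s → N < s + ℓ → s + d ≤ suc N → s + d + ℓ ≤ suc (N + r) →
                       Split ℓ ⊎ (∀ x → w x ≡ w (suc r + d′ * x))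
    reflection-above s r<s N<s+ℓ s+d≤1+N s+d+ℓ≤1+N+r =
      bind (collect d hit) λ h → inj₂ (block s d-periodic (reflect-periodic (suc r)) h)
      where
      hit : ∀ t → t < d → Split ℓ ⊎ w (s + t) ≡ w (suc r + d′ * (s + t))
      hit t t<d
        with difference (≤-trans (+-monoʳ-≤ s (s≤s⁻¹ t<d)) (s≤s⁻¹ (subst (_≤ suc N) (+-suc s d′) s+d≤1+N)))
           | difference (<-≤-trans N<s+ℓ (+-monoˡ-≤ ℓ (m≤m+n s t)))
      ... | j , x+j≡N | f , N+f≡x+ℓ with difference (bound N f s t ℓ d r N+f≡x+ℓ t<d s+d+ℓ≤1+N+r)
        where
        bound : ∀ N f s t ℓ d r → suc N + f ≡ s + t + ℓ → t < d → s + d + ℓ ≤ suc (N + r) → f < r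
        bound N f s t ℓ d r eq t<d le = ≤-by 0 (+-mono-≤ t<d le)
          (trans (eq₁ f d N r) (trans (cong (λ y → d + r + 1 + y) eq) (eq₂ d r s t ℓ)))
          where
          eq₁ : ∀ f d N r → suc f + (d + suc (N + r)) + 0 ≡ d + r + 1 + (suc N + f)
          eq₁ = solve-∀
          eq₂ : ∀ d r s t ℓ → d + r + 1 + (s + t + ℓ) ≡ r + (suc t + (s + d + ℓ))
          eq₂ = solve-∀
      ...   | b , f+b≡r =
        bind (subst (λ l → Split l ⊎ w x ≡ w (suc b)) length≡ℓ
               (above-chord-below x+j≡N (<-≤-trans r<s (m≤m+n s t)) (s≤s z≤n) (trans (cong suc (+-comm b f)) f+b≡r))) λ eq →
        inj₂ (trans eq (trans (sym (ℓ-periodic (suc b))) (trans (sym (periodic-* {d} {w} d-periodic (suc b + ℓ) x))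
          (trans (cong w position) (w-periodic (suc r + d′ * x))))))
        where
        x : ℕ
        x = s + t
        length≡ℓ : suc (j + f) ≡ ℓ
        length≡ℓ = +-cancelˡ-≡ x _ _ (trans (eq₁ x j f) (trans (cong (λ y → suc y + f) x+j≡N) N+f≡x+ℓ))
          where
          eq₁ : ∀ x j f → x + suc (j + f) ≡ suc (x + j) + f
          eq₁ = solve-∀
        position : suc b + ℓ + d * x ≡ suc r + d′ * x + N
        position = trans (eq₁ b ℓ d′ x) (trans (cong (λ y → suc b + d′ * x + y) (sym N+f≡x+ℓ))
          (trans (eq₂ b d′ x N f) (cong (λ y → suc y + d′ * x + N) f+b≡r)))
          where
          eq₁ : ∀ b ℓ d′ x → suc b + ℓ + suc d′ * x ≡ suc b + d′ * x + (x + ℓ)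
          eq₁ = solve-∀
          eq₂ : ∀ b d′ x N f → suc b + d′ * x + (suc N + f) ≡ suc (suc f + b) + d′ * x + N
          eq₂ = solve-∀

    -- The counterpart on the other side: down from x to 0, over the chord and up, which ends at r -
    -- 1 - x modulo the periods. The bounds keep x below r and below ℓ, and the end below N.
    reflection-below : ∀ s → s + d ≤ r → s + d ≤ ℓ → r + ℓ ≤ N + s →
                       Split ℓ ⊎ (∀ x → w x ≡ w (r′ + d′ * x))
    reflection-below s s+d≤r s+d≤ℓ r+ℓ≤N+s =
      bind (collect d hit) λ h → inj₂ (block s d-periodic (reflect-periodic r′) h)
      where
      hit : ∀ t → t < d → Split ℓ ⊎ w (s + t) ≡ w (r′ + d′ * (s + t))
      hit t t<d with difference (<-≤-trans (+-monoʳ-< s t<d) s+d≤ℓ)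
      ... | f , x+f≡ℓ =
        bind (subst (λ l → Split l ⊎ w x ≡ w (r + f)) x+f≡ℓ
               (below-chord-above (<-≤-trans (+-monoʳ-< s t<d) s+d≤r) (bound r f s t ℓ N x+f≡ℓ r+ℓ≤N+s))) λ eq →
        inj₂ (trans eq (trans (sym (periodic-* {d} {w} d-periodic (r + f) x))
          (trans (cong w (trans (position r′ f d′ x) (cong (r′ + d′ * x +_) x+f≡ℓ))) (ℓ-periodic (r′ + d′ * x)))))
        where
        x : ℕ
        x = s + t
        bound : ∀ r f s t ℓ N → suc (s + t) + f ≡ ℓ → r + ℓ ≤ N + s → r + f < N
        bound r f s t _ N refl le = ≤-by t le (eq r f s t N)
          where
          eq : ∀ r f s t N → suc (r + f) + (N + s) + t ≡ N + (r + (suc (s + t) + f))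
          eq = solve-∀
        position : ∀ r′ f d′ x → suc r′ + f + suc d′ * x ≡ r′ + d′ * x + (suc x + f)
        position = solve-∀

    -- The reflections x ↦ r + 1 - x and x ↦ r - 1 - x both preserve `w`, and together they give the
    -- translation by 2.
    far : d ≤ r → r + d ≤ N → Split ℓ ⊎ TwoPeriodic
    far d≤r r+d≤N =
      bind above λ h₁ → bind below λ h₂ → inj₂ λ x →
      trans (h₁ (x + 2)) (trans (cong w (eq r′ d′ x)) (trans (periodic-* {d} {w} d-periodic (r′ + d′ * x) 2) (sym (h₂ x))))
      where
      eq : ∀ r′ d′ x → suc (suc r′) + d′ * (x + 2) ≡ r′ + d′ * x + suc d′ * 2
      eq = solve-∀
      -- The block must start above both r and N - ℓ; the least such start is taken, r + 1 or N - ℓ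
      -- + 1.
      above : Split ℓ ⊎ (∀ x → w x ≡ w (suc r + d′ * x))
      above with ≤-total N (r + ℓ)
      ... | inj₁ N≤r+ℓ =
        reflection-above (suc r) ≤-refl (s≤s N≤r+ℓ) (s≤s r+d≤N)
          (≤-by 0 ℓ+d≤N (eq₁ r d ℓ N))
        where
        eq₁ : ∀ r d ℓ N → suc r + d + ℓ + N + 0 ≡ suc (N + r) + (ℓ + d)
        eq₁ = solve-∀
      ... | inj₂ r+ℓ≤N with difference r+ℓ≤N
      ...   | m , r+ℓ+m≡N =
        reflection-above (suc (r + m)) (s≤s (m≤m+n r m)) (s≤s (≤-reflexive (trans (sym r+ℓ+m≡N) (eq₁ r ℓ m))))
          (s≤s (≤-trans (≤-by 0 d≤ℓ (eq₂ r m d ℓ)) (≤-reflexive r+ℓ+m≡N)))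
          (s≤s (≤-trans (≤-by 0 d≤r (eq₃ r m d ℓ)) (≤-reflexive (cong (_+ r) r+ℓ+m≡N))))
        where
        eq₁ : ∀ r ℓ m → r + ℓ + m ≡ r + m + ℓ
        eq₁ = solve-∀
        eq₂ : ∀ r m d ℓ → r + m + d + ℓ + 0 ≡ r + ℓ + m + d
        eq₂ = solve-∀
        eq₃ : ∀ r m d ℓ → r + m + d + ℓ + r + 0 ≡ r + ℓ + m + r + d
        eq₃ = solve-∀
      -- The block must start at r + ℓ - N or later; the least such start is taken, which is 0 when
      -- r + ℓ ≤ N.
      below : Split ℓ ⊎ (∀ x → w x ≡ w (r′ + d′ * x))
      below with ≤-total N (r + ℓ)
      ... | inj₂ r+ℓ≤N = reflection-below 0 d≤r d≤ℓ (≤-trans r+ℓ≤N (≤-reflexive (sym (+-identityʳ N))))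
      ... | inj₁ N≤r+ℓ with difference N≤r+ℓ
      ...   | s , N+s≡r+ℓ =
        reflection-below s (bound₁ r d ℓ N s ℓ+d≤N N+s≡r+ℓ) (bound₂ r d ℓ N s r+d≤N N+s≡r+ℓ) (≤-reflexive (sym N+s≡r+ℓ))
        where
        bound₁ : ∀ r d ℓ N s → ℓ + d ≤ N → N + s ≡ r + ℓ → s + d ≤ r
        bound₁ r d ℓ N s le eq = ≤-by 0 le (trans (e₁ s d N) (trans (cong (_+ d) eq) (e₂ r ℓ d)))
          where
          e₁ : ∀ s d N → s + d + N + 0 ≡ N + s + d
          e₁ = solve-∀
          e₂ : ∀ r ℓ d → r + ℓ + d ≡ r + (ℓ + d)
          e₂ = solve-∀
        bound₂ : ∀ r d ℓ N s → r + d ≤ N → N + s ≡ r + ℓ → s + d ≤ ℓ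
        bound₂ r d ℓ N s le eq = bound₁ ℓ d r N s le (trans eq (+-comm r ℓ))

    conclusion : Split ℓ ⊎ TwoPeriodic
    conclusion with r <? d | N <? r + d
    ... | yes r<d | _           = near-above r<d
    ... | no _    | yes N<r+d   = near-below N<r+d
    ... | no r≮d  | no N≮r+d    = far (≮⇒≥ r≮d) (≮⇒≥ N≮r+d)

  -- Arcs of the cycle are tried first. Only when all of them fail, so that ℓ is a period of `w`,
  -- are paths over the chord considered.
  theta : ∀ ℓ → 1 ≤ ℓ → ℓ < N → Split ℓ ⊎ TwoPeriodic
  theta ℓ 1≤ℓ ℓ<N = bind (collect N (arc ℓ 1≤ℓ ℓ<N)) λ h →
    from-period (block 0 (λ x → trans (cong w (eq x N ℓ)) (w-periodic (x + ℓ))) w-periodic λ t t<N → sym (h t t<N))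
    where
    eq : ∀ x N ℓ → x + N + ℓ ≡ x + ℓ + N
    eq = solve-∀
    Period : ℕ → Set
    Period p = ∀ {x} → x < N → w (x + suc p) ≡ w x
    extend : ∀ {p} → Period p → Periodic (suc p) w
    extend {p} h = block 0 (λ x → trans (cong w (eq x N (suc p))) (w-periodic (x + suc p))) w-periodic λ t t<N → h t<N
    from-period : Periodic ℓ w → Split ℓ ⊎ TwoPeriodic
    from-period ℓ-periodic
      -- Testing a period on one turn of the cycle is decidable, and N itself is a period, so a
      -- least one exists.
      with least {Period} (λ p → allUpTo? (λ x → w (x + suc p) Bool.≟ w x) N) N′ (λ {x} _ → w-periodic x)
    ... | d′ , d-period , _ , d-least =
      Periods.conclusion d′ ℓ (extend d-period)
        (λ { {suc p} _ per → ≮⇒≥ λ p<d → d-least (s≤s⁻¹ p<d) λ {x} _ → per x })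
        1≤ℓ ℓ<N ℓ-periodic

-- Degree sums

indicator : Bool → ℕ
indicator false = 0
indicator true  = 1

∑ : {A : Set} → List A → (A → ℕ) → ℕ
∑ xs f = sum (map f xs)

∑-cong : {A : Set} (xs : List A) {f g : A → ℕ} → (∀ x → f x ≡ g x) → ∑ xs f ≡ ∑ xs g
∑-cong xs h = cong sum (List.map-cong h xs)

∑-↭ : {A : Set} {xs ys : List A} (f : A → ℕ) → xs ↭ ys → ∑ xs f ≡ ∑ ys f
∑-↭ f p = sum-↭ (↭-map⁺ f p)

∑-++ : {A : Set} (xs ys : List A) (f : A → ℕ) → ∑ (xs ++ ys) f ≡ ∑ xs f + ∑ ys f
∑-++ xs ys f = trans (cong sum (List.map-++ f xs ys)) (sum-++ (map f xs) (map f ys))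

∑-map : {A B : Set} (g : A → B) (xs : List A) (f : B → ℕ) → ∑ (map g xs) f ≡ ∑ xs (f ∘ g)
∑-map g xs f = cong sum (sym (List.map-∘ xs))

∑-+ : {A : Set} (xs : List A) (f g : A → ℕ) → ∑ xs (λ x → f x + g x) ≡ ∑ xs f + ∑ xs g
∑-+ []       f g = refl
∑-+ (x ∷ xs) f g = trans (cong (f x + g x +_) (∑-+ xs f g)) (interchange (f x) (g x) (∑ xs f) (∑ xs g))
  where
  interchange : ∀ a b c d → a + b + (c + d) ≡ a + c + (b + d)
  interchange = solve-∀

∑-zero : {A : Set} (xs : List A) → ∑ xs (λ _ → 0) ≡ 0
∑-zero []       = refl
∑-zero (_ ∷ xs) = ∑-zero xs

∑-swap : {A B : Set} (xs : List A) (ys : List B) (f : A → B → ℕ) →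
         ∑ xs (λ x → ∑ ys (f x)) ≡ ∑ ys (λ y → ∑ xs (λ x → f x y))
∑-swap []       ys f = sym (∑-zero ys)
∑-swap (x ∷ xs) ys f =
  trans (cong (∑ ys (f x) +_) (∑-swap xs ys f)) (sym (∑-+ ys (f x) (λ y → ∑ xs (λ x′ → f x′ y))))

∑-cartesianProduct : {A B : Set} (xs : List A) (ys : List B) (f : A × B → ℕ) →
                     ∑ (cartesianProduct xs ys) f ≡ ∑ xs (λ x → ∑ ys (λ y → f (x , y)))
∑-cartesianProduct []       ys f = refl
∑-cartesianProduct (x ∷ xs) ys f =
  trans (∑-++ (map (x ,_) ys) (cartesianProduct xs ys) f)
    (cong₂ _+_ (∑-map (x ,_) ys f) (∑-cartesianProduct xs ys f))

length-filterᵇ : {A : Set} (p : A → Bool) (xs : List A) → length (filterᵇ p xs) ≡ ∑ xs (indicator ∘ p)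
length-filterᵇ p []       = refl
length-filterᵇ p (x ∷ xs) with p x
... | true  = cong suc (length-filterᵇ p xs)
... | false = length-filterᵇ p xs

module Peeling {A : Set} (e : A → A → Bool) (e-sym : ∀ x y → e x y ≡ e y x) (e-irrefl : ∀ x → e x x ≡ false) where

  deg : List A → A → ℕ
  deg xs x = ∑ xs (indicator ∘ e x)

  total : List A → ℕ
  total xs = ∑ xs (deg xs)

  total-↭ : ∀ {xs ys} → xs ↭ ys → total xs ≡ total ys
  total-↭ {xs} {ys} p = trans (∑-cong xs λ x → ∑-↭ (indicator ∘ e x) p) (∑-↭ (deg ys) p)

  -- Each edge at x is counted once at x and once at its other end; there is no loop at x.
  total-∷ : ∀ x xs → total (x ∷ xs) ≡ 2 * deg xs x + total xs
  total-∷ x xs = begin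
    indicator (e x x) + deg xs x + ∑ xs (λ y → indicator (e y x) + deg xs y)
      ≡⟨ cong₂ (λ a b → indicator a + deg xs x + b) (e-irrefl x) (∑-+ xs (λ y → indicator (e y x)) (deg xs)) ⟩
    deg xs x + (∑ xs (λ y → indicator (e y x)) + total xs)
      ≡⟨ cong (λ a → deg xs x + (a + total xs)) (∑-cong xs λ y → cong indicator (e-sym y x)) ⟩
    deg xs x + (deg xs x + total xs)
      ≡⟨ double (deg xs x) (total xs) ⟩
    2 * deg xs x + total xs ∎
    where
    open ≡-Reasoning
    double : ∀ a b → a + (a + b) ≡ 2 * a + b
    double = solve-∀

  -- Deleting a vertex of degree at most k removes at most 2k from the degree sum, so the density hypothesis persists.
  peel : ∀ k → 1 ≤ k → ∀ m xs → length xs ≡ suc m → Unique xs → 2 * k * length xs ≤ total xs →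
         Σ[ ys ∈ List A ] Σ[ y ∈ A ] y ∈ ys × Unique ys × (∀ {x} → x ∈ ys → k < deg ys x)
  peel k 1≤k m xs len u dense with Any.any? (λ x → deg xs x ≤? k) xs
  peel k 1≤k m xs@(x ∷ _) len u dense | no ¬low = xs , x , here refl , u , λ x∈ → ≰⇒> λ d≤k → ¬low (lose x∈ d≤k)
  peel k 1≤k m xs len u dense | yes low with find low
  ... | x , x∈ , d≤k with ∈-∃++ x∈
  ...   | as , bs , refl = go m len u′ dense″
    where
    ys : List A
    ys = as ++ bs
    p : as ++ x ∷ bs ↭ x ∷ ys
    p = shift x as bs
    tail : ∀ {z zs} → Unique (z ∷ zs) → Unique zs
    tail (_ ∷ v) = v
    u′ : Unique ys
    u′ = tail (unique-resp-↭ p u)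
    d≤k′ : deg ys x ≤ k
    d≤k′ = ≤-trans (≤-trans (m≤n+m _ (indicator (e x x))) (≤-reflexive (sym (∑-↭ (indicator ∘ e x) p)))) d≤k
    dense″ : 2 * k * length (x ∷ ys) ≤ 2 * deg ys x + total ys
    dense″ = subst₂ _≤_ (cong (2 * k *_) (↭-length p)) (trans (total-↭ p) (total-∷ x ys)) dense
    go : ∀ m → length (as ++ x ∷ bs) ≡ suc m → Unique ys → 2 * k * length (x ∷ ys) ≤ 2 * deg ys x + total ys →
         Σ[ zs ∈ List A ] Σ[ y ∈ A ] y ∈ zs × Unique zs × (∀ {x} → x ∈ zs → k < deg zs x)
    -- Here the deleted vertex was the only one, so the density hypothesis reads 2k ≤ 0.
    go zero len _ dense with as ++ bs | trans (sym (↭-length p)) len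
    ... | []    | _ = ⊥-elim (<-irrefl refl (≤-trans (*-mono-≤ (*-mono-≤ (s≤s (z≤n {1})) 1≤k) (≤-refl {1})) dense))
    go (suc m) len u dense =
      peel k 1≤k m ys (suc-injective (trans (sym (↭-length p)) len)) u
        (≤-by 0 (+-mono-≤ dense (*-monoʳ-≤ 2 d≤k′)) (eq k (length ys) (deg ys x) (total ys)))
      where
      eq : ∀ k l d t → 2 * k * l + (2 * d + t + 2 * k) + 0 ≡ t + (2 * k * suc l + 2 * d)
      eq = solve-∀

-- Breadth-first forests

module Distance (G : Graph) where

  V : Set
  V = Fin (n G)

  adj-sym : ∀ {u v} → Adj G u v → Adj G v u
  adj-sym {u} {v} = subst T (Graph.sym G u v)

  walk? : ∀ m (u v : V) → Dec (Walk G u v m)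
  walk? zero u v with u Fin.≟ v
  ... | yes refl = yes here
  ... | no u≢v   = no λ { here → u≢v refl }
  walk? (suc m) u v =
    map′ (λ { (_ , e , p) → step e p }) (λ { (step e p) → _ , e , p })
      (Fin.any? λ w → T? (adj G u w) ×-dec walk? m w v)

  dist? : ∀ r (u v : V) → Dec (DistAtMost G u v r)
  dist? r u v =
    map′ (λ { (m , m<1+r , p) → m , s≤s⁻¹ m<1+r , p }) (λ { (m , m≤r , p) → m , s≤s m≤r , p })
      (anyUpTo? (λ m → walk? m u v) (suc r))

  radius? : ∀ r → Dec (RadiusAtMost G r)
  radius? r = Fin.any? λ v → Fin.all? λ u → dist? r u v

  route-suffix : ∀ {u w v xs} → u ∈ xs → Route (Adj G) w xs v → Unique xs →
                 Σ[ ys ∈ List V ] Unique ys × Route (Adj G) u ys v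
  route-suffix (here refl) [·]     un       = _ , un , [·]
  route-suffix (here refl) (e ∷ p) un       = _ , un , e ∷ p
  route-suffix (there u∈)  (e ∷ p) (_ ∷ un) = route-suffix u∈ p un

  -- Loop erasure: when the new first vertex already occurs later, the route is restarted at that
  -- occurrence.
  walk⇒route : ∀ {u v m} → Walk G u v m → Σ[ xs ∈ List V ] Unique xs × Route (Adj G) u xs v
  walk⇒route here = _ , [] ∷ [] , [·]
  walk⇒route (step {u} e p) with walk⇒route p
  ... | xs , un , q with DecMembership._∈?_ Fin._≟_ u xs
  ...   | yes u∈ = route-suffix u∈ q un
  ...   | no u∉  = u ∷ xs , All.¬Any⇒All¬ xs u∉ ∷ un , e ∷ q

  route⇒walk : ∀ {u v xs} → Route (Adj G) u xs v → DistAtMost G u v (length xs)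
  route⇒walk [·] = 0 , z≤n , here
  route⇒walk (e ∷ p) with route⇒walk p
  ... | m , m≤ , q = suc m , s≤s m≤ , step e q

  weaken : ∀ {u v r s} → r ≤ s → DistAtMost G u v r → DistAtMost G u v s
  weaken r≤s (m , m≤r , p) = m , ≤-trans m≤r r≤s , p

  -- A route without repetitions has at most `n G` vertices. Reachability thus becomes the decidable
  -- property of lying within distance `n G`.
  shorten : ∀ {u v m} → Walk G u v m → DistAtMost G u v (n G)
  shorten p with walk⇒route p
  ... | xs , un , q =
    weaken (≤-trans (unique-⊆-length un λ _ → ∈-allFin _) (≤-reflexive (List.length-tabulate id))) (route⇒walk q)

  record Rooted : Set where
    field
      root     : V → V
      reach    : ∀ v → ∃ (Walk G v (root v))
      root-adj : ∀ {u v} → Adj G u v → root u ≡ root v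
      central  : ∀ r → RadiusAtMost G r → ∀ v → DistAtMost G v (root v) r

  -- A connected graph is rooted at a centre; otherwise each component is rooted at its least vertex, and no radius exists.
  rooted : Rooted
  rooted with radius? (n G)
  ... | yes connected with least radius? (n G) connected
  ...   | r₀ , (c , dist) , _ , least-r₀ = record
    { root     = const c
    ; reach    = λ v → proj₁ (dist v) , proj₂ (proj₂ (dist v))
    ; root-adj = λ _ → refl
    ; central  = λ r rad v → weaken (≮⇒≥ λ r<r₀ → least-r₀ r<r₀ rad) (dist v)
    }
  rooted | no disconnected = record
    { root     = λ v → proj₁ (proj₁ (proj₂ (first v)))
    ; reach    = λ v → let _ , (_ , _ , m , _ , p) , _ = first v in m , p
    ; root-adj = λ e → Fin.toℕ-injective (≤-antisym (earlier e) (earlier (adj-sym e)))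
    ; central  = λ { r (c , dist) v → ⊥-elim (disconnected (c , λ u → shorten (proj₂ (proj₂ (dist u))))) }
    }
    where
    Reaches : V → ℕ → Set
    Reaches v t = Σ[ w ∈ V ] toℕ w ≡ t × DistAtMost G v w (n G)
    first : ∀ v → Σ[ t ∈ ℕ ] Reaches v t × t ≤ toℕ v × (∀ {s} → s < t → ¬ Reaches v s)
    first v = least (λ t → Fin.any? λ w → (toℕ w ≟ t) ×-dec dist? (n G) v w) (toℕ v) (v , refl , 0 , z≤n , here)
    -- Whatever v reaches, its neighbour u reaches through v, so the least vertex reached from u
    -- comes no later.
    earlier : ∀ {u v} → Adj G u v → toℕ (proj₁ (proj₁ (proj₂ (first u)))) ≤ toℕ (proj₁ (proj₁ (proj₂ (first v))))
    earlier {u} {v} e with first u | first v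
    ... | t , (x , x≡t , _) , _ , least-t | s , (y , y≡s , _ , _ , p) , _ =
      subst₂ _≤_ (sym x≡t) (sym y≡s) (≮⇒≥ λ s<t → least-t s<t (y , y≡s , shorten (step e p)))

-- All that is used of breadth-first search. The laws for `parent` concern positive levels only.
-- Bounding every level by the radius is what later bounds the shortest cycle.
record Forest (G : Graph) : Set where
  field
    root         : Fin (n G) → Fin (n G)
    level        : Fin (n G) → ℕ
    parent       : Fin (n G) → Fin (n G)
    root-adj     : ∀ {u v} → Adj G u v → root u ≡ root v
    level-adj    : ∀ {u v} → Adj G u v → level v ≡ suc (level u) ⊎ level u ≡ suc (level v)
    parent-adj   : ∀ {v m} → level v ≡ suc m → Adj G v (parent v)
    parent-level : ∀ {v m} → level v ≡ suc m → level (parent v) ≡ m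
    level-zero   : ∀ {v} → level v ≡ 0 → v ≡ root v
    level-radius : ∀ r → RadiusAtMost G r → ∀ v → level v ≤ r

alternate : ℕ → Bool → Bool
alternate zero    b = b
alternate (suc m) b = not (alternate m b)

alternate-even : ∀ m b → alternate (2 * m) b ≡ b
alternate-even zero    b = refl
alternate-even (suc m) b =
  trans (cong (λ l → alternate l b) (*-suc 2 m)) (trans (Bool.not-involutive _) (alternate-even m b))

module _ (G : Graph) (bipartite : Bipartite G) where
  open Distance G
  open Rooted rooted

  private
    colour : V → Bool
    colour = proj₁ bipartite

    walk-colour : ∀ {u v m} → Walk G u v m → colour u ≡ alternate m (colour v)
    walk-colour here       = refl
    walk-colour (step e p) = trans (Bool.¬-not (proj₂ bipartite _ _ e)) (cong not (walk-colour p))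

    nearest : ∀ v → Σ[ m ∈ ℕ ] Walk G v (root v) m × m ≤ proj₁ (reach v) × (∀ {s} → s < m → ¬ Walk G v (root v) s)
    nearest v = least (λ m → walk? m v (root v)) (proj₁ (reach v)) (proj₂ (reach v))

    depth : V → ℕ
    depth v = proj₁ (nearest v)

    depth-walk : ∀ v → Walk G v (root v) (depth v)
    depth-walk v = proj₁ (proj₂ (nearest v))

    depth-least : ∀ {v m} → Walk G v (root v) m → depth v ≤ m
    depth-least {v} p = ≮⇒≥ λ m<d → proj₂ (proj₂ (proj₂ (nearest v))) m<d p

    first-step : ∀ {v w m} → Walk G v w m → V
    first-step (here {v})       = v
    first-step (step {w = w} _ _) = w

    depth-adj-≤ : ∀ {u v} → Adj G u v → depth u ≤ suc (depth v)
    depth-adj-≤ {u} {v} e =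
      depth-least (step e (subst (λ w → Walk G v w (depth v)) (sym (root-adj e)) (depth-walk v)))

    -- A walk to the common root determines the colour of its start from the parity of its length,
    -- so equal depths would give the ends of an edge equal colours.
    depth-adj-≢ : ∀ {u v} → Adj G u v → depth u ≢ depth v
    depth-adj-≢ {u} {v} e eq = proj₂ bipartite u v e
      (trans (walk-colour (depth-walk u)) (trans (cong₂ alternate eq (cong colour (root-adj e))) (sym (walk-colour (depth-walk v)))))

    step-adj : ∀ {v w m k} → k ≡ suc m → (p : Walk G v w k) → Adj G v (first-step p)
    step-adj _ (step e _) = e

    step-walk : ∀ {v w m k} → k ≡ suc m → (p : Walk G v w k) → Walk G (first-step p) w m
    step-walk refl (step _ p) = p

    zero-walk : ∀ {v w k} → k ≡ 0 → Walk G v w k → v ≡ w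
    zero-walk _ here = refl

  forest : Forest G
  forest = record
    { root         = root
    ; level        = depth
    ; parent       = λ v → first-step (depth-walk v)
    ; root-adj     = root-adj
    ; level-adj    = λ {u} {v} e → compare e
    ; parent-adj   = λ {v} eq → step-adj eq (depth-walk v)
    ; parent-level = λ {v} {m} eq → parent-depth v m eq
    ; level-zero   = λ {v} eq → zero-walk eq (depth-walk v)
    ; level-radius = λ r rad v → let _ , m≤r , p = central r rad v in ≤-trans (depth-least p) m≤r
    }
    where
    compare : ∀ {u v} → Adj G u v → depth v ≡ suc (depth u) ⊎ depth u ≡ suc (depth v)
    compare {u} {v} e with <-cmp (depth u) (depth v)
    ... | tri< lt _ _ = inj₁ (≤-antisym (depth-adj-≤ (adj-sym e)) lt)
    ... | tri≈ _ eq _ = ⊥-elim (depth-adj-≢ e eq)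
    ... | tri> _ _ gt = inj₂ (≤-antisym (depth-adj-≤ e) gt)
    parent-depth : ∀ v m → depth v ≡ suc m → depth (first-step (depth-walk v)) ≡ m
    parent-depth v m eq = ≤-antisym
      (depth-least (subst (λ x → Walk G w x m) (root-adj v~w) (step-walk eq (depth-walk v))))
      (s≤s⁻¹ (subst (_≤ suc (depth w)) eq (depth-adj-≤ v~w)))
      where
      w : V
      w = first-step (depth-walk v)
      v~w : Adj G v w
      v~w = step-adj eq (depth-walk v)

-- Layers between consecutive levels

-- Each vertex v is split in two: (v , true) keeps the edges going up one level, (v , false) those going down one level.
-- Every component of the split graph then lies between two consecutive levels.
module SplitGraph (G : Graph) (F : Forest G) where
  open Forest F

  V V₂ : Set
  V = Fin (n G)
  V₂ = V × Bool

  rises : V → V → Bool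
  rises u v = adj G u v ∧ (level v ≡ᵇ suc (level u))

  link : V₂ → V₂ → Bool
  link (u , true)  (v , false) = rises u v
  link (u , false) (v , true)  = rises v u
  link (u , true)  (v , true)  = false
  link (u , false) (v , false) = false

  link-sym : ∀ x y → link x y ≡ link y x
  link-sym (u , true)  (v , true)  = refl
  link-sym (u , true)  (v , false) = refl
  link-sym (u , false) (v , true)  = refl
  link-sym (u , false) (v , false) = refl

  link-irrefl : ∀ x → link x x ≡ false
  link-irrefl (u , true)  = refl
  link-irrefl (u , false) = refl

  InLayer : ℕ → V₂ → Set
  InLayer i (v , true)  = level v ≡ i
  InLayer i (v , false) = level v ≡ suc i

  rises⁻ : ∀ {u v} → T (rises u v) → Adj G u v × level v ≡ suc (level u)
  rises⁻ {u} {v} t with adj G u v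
  ... | true = _ , ≡ᵇ⇒≡ _ _ t

  link⇒adj : ∀ {x y} → T (link x y) → Adj G (proj₁ x) (proj₁ y)
  link⇒adj {u , true}  {v , false} t = proj₁ (rises⁻ {u} t)
  link⇒adj {u , false} {v , true}  t = subst T (Graph.sym G v u) (proj₁ (rises⁻ {v} t))

  link⇒layer : ∀ {x y} → T (link x y) → Σ[ i ∈ ℕ ] InLayer i x
  link⇒layer {u , true}  {v , false} t = level u , refl
  link⇒layer {u , false} {v , true}  t = level v , proj₂ (rises⁻ {v} t)

  link-layer : ∀ {i x y} → T (link x y) → InLayer i x → InLayer i y
  link-layer {x = u , true}  {v , false} t refl = proj₂ (rises⁻ {u} t)
  link-layer {x = u , false} {v , true}  t eq   = suc-injective (trans (sym (proj₂ (rises⁻ {v} t))) eq)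

  link-flips : ∀ {x y} → T (link x y) → proj₂ y ≡ not (proj₂ x)
  link-flips {u , true}  {v , false} t = refl
  link-flips {u , false} {v , true}  t = refl

  -- The two halves of a vertex belong to different layers. Paths within one layer therefore project
  -- to paths of G.
  layer-injective : ∀ {i x y} → InLayer i x → InLayer i y → proj₁ x ≡ proj₁ y → x ≡ y
  layer-injective {x = u , true}  {v , true}  p q refl = refl
  layer-injective {x = u , true}  {v , false} p q refl = ⊥-elim (1+n≢n (trans (sym q) p))
  layer-injective {x = u , false} {v , true}  p q refl = ⊥-elim (1+n≢n (trans (sym p) q))
  layer-injective {x = u , false} {v , false} p q refl = refl

  layer-≤ : ∀ {i x} → InLayer i x → i ≤ level (proj₁ x)
  layer-≤ {x = u , true}  refl = ≤-refl
  layer-≤ {x = u , false} eq   = subst (_ ≤_) (sym eq) (n≤1+n _)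

  linked-layer : ∀ {i x xs} → Linked (λ x y → T (link x y)) (x ∷ xs) → InLayer i x → All (InLayer i) (x ∷ xs)
  linked-layer [-]     p = p ∷ []
  linked-layer {x = x} (_∷_ {y = y} t l) p = p ∷ linked-layer l (link-layer {x = x} {y} t p)

  vertices : List V
  vertices = allFin (n G)

  all₂ : List V₂
  all₂ = map (_, true) vertices ++ map (_, false) vertices

  all₂-length : length all₂ ≡ n G + n G
  all₂-length = trans (List.length-++ (map (_, true) vertices))
    (cong₂ _+_ (copies true) (copies false))
    where
    copies : ∀ b → length (map (_, b) vertices) ≡ n G
    copies b = trans (List.length-map (_, b) vertices) (List.length-tabulate {n = n G} id)

  all₂-unique : Unique all₂
  all₂-unique = Unique.++⁺ (Unique.map⁺ (λ { refl → refl }) (Unique.allFin⁺ (n G))) (Unique.map⁺ (λ { refl → refl }) (Unique.allFin⁺ (n G)))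
    λ { (x∈ , y∈) → clash (∈-map⁻ _ x∈) (∈-map⁻ _ y∈) }
    where
    clash : ∀ {x : V₂} {P Q : V → Set} → (Σ[ u ∈ V ] P u × x ≡ (u , true)) → (Σ[ u ∈ V ] Q u × x ≡ (u , false)) → ⊥
    clash (_ , _ , refl) (_ , _ , ())

  open Peeling link link-sym link-irrefl public

  ∑∑ : (V → V → ℕ) → ℕ
  ∑∑ f = ∑ vertices λ u → ∑ vertices (f u)

  ∑∑-+ : ∀ f g → ∑∑ (λ u v → f u v + g u v) ≡ ∑∑ f + ∑∑ g
  ∑∑-+ f g = trans (∑-cong vertices λ u → ∑-+ vertices (f u) (g u)) (∑-+ vertices (λ u → ∑ vertices (f u)) (λ u → ∑ vertices (g u)))

  rise : V → V → ℕ
  rise u v = indicator (rises u v)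

  -- The upward halves contribute every rising edge once, and so do the downward halves after
  -- exchanging the summations.
  total-all₂ : total all₂ ≡ ∑∑ rise + ∑∑ rise
  total-all₂ = trans (∑-++ (map (_, true) vertices) (map (_, false) vertices) (deg all₂)) (cong₂ _+_
    (trans (∑-map (_, true) vertices (deg all₂)) (∑-cong vertices λ u →
      trans (∑-++ (map (_, true) vertices) (map (_, false) vertices) (indicator ∘ link (u , true)))
        (cong₂ _+_ (trans (∑-map (_, true) vertices (indicator ∘ link (u , true))) (∑-zero vertices))
          (∑-map (_, false) vertices (indicator ∘ link (u , true))))))
    (trans (trans (∑-map (_, false) vertices (deg all₂)) (∑-cong vertices λ u →
      trans (∑-++ (map (_, true) vertices) (map (_, false) vertices) (indicator ∘ link (u , false)))
        (trans (cong₂ _+_ (∑-map (_, true) vertices (indicator ∘ link (u , false)))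
            (trans (∑-map (_, false) vertices (indicator ∘ link (u , false))) (∑-zero vertices)))
          (+-identityʳ _))))
      (∑-swap vertices vertices (λ u v → rise v u))))

  ordered : V → V → ℕ
  ordered u v = indicator ((toℕ u <ᵇ toℕ v) ∧ adj G u v)

  -- Both sides count an edge uv once.
  orient : ∀ u v → ordered u v + ordered v u ≡ rise u v + rise v u
  orient u v with adj G u v in uv | adj G v u | Graph.sym G u v
  ... | false | _ | refl = cong₂ (λ a b → indicator a + indicator b) (Bool.∧-zeroʳ (toℕ u <ᵇ toℕ v)) (Bool.∧-zeroʳ (toℕ v <ᵇ toℕ u))
  ... | true  | _ | refl = trans (one-order (<-cmp (toℕ u) (toℕ v))) (sym (one-rise (level-adj (subst T (sym uv) _))))
    where
    one-order : _ → indicator ((toℕ u <ᵇ toℕ v) ∧ true) + indicator ((toℕ v <ᵇ toℕ u) ∧ true) ≡ 1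
    one-order (tri< u<v _ v≮u) rewrite dec-true (toℕ u <? toℕ v) u<v | dec-false (toℕ v <? toℕ u) v≮u = refl
    one-order (tri> u≮v _ v<u) rewrite dec-true (toℕ v <? toℕ u) v<u | dec-false (toℕ u <? toℕ v) u≮v = refl
    one-order (tri≈ _ u≡v _) with refl ← Fin.toℕ-injective u≡v with () ← trans (sym uv) (irrefl G u)
    one-rise : level v ≡ suc (level u) ⊎ level u ≡ suc (level v) →
               indicator (level v ≡ᵇ suc (level u)) + indicator (level u ≡ᵇ suc (level v)) ≡ 1
    one-rise (inj₁ up)
      rewrite dec-true (level v ≟ suc (level u)) up
            | dec-false (level u ≟ suc (level v)) (λ down → <-irrefl (trans down (cong suc up)) (s≤s (n≤1+n _))) = refl
    one-rise (inj₂ down)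
      rewrite dec-true (level u ≟ suc (level v)) down
            | dec-false (level v ≟ suc (level u)) (λ up → <-irrefl (trans up (cong suc down)) (s≤s (n≤1+n _))) = refl

  -- `numEdges` orients each edge by vertex number, `rise` by level. Symmetrising both in u and v
  -- removes the difference.
  edges-rise : 2 * numEdges G ≡ ∑∑ rise + ∑∑ rise
  edges-rise = begin
    2 * numEdges G                                    ≡⟨ cong (2 *_) (trans (length-filterᵇ _ (cartesianProduct vertices vertices)) (∑-cartesianProduct vertices vertices _)) ⟩
    2 * ∑∑ ordered                                    ≡⟨ cong (∑∑ ordered +_) (+-identityʳ _) ⟩
    ∑∑ ordered + ∑∑ ordered                           ≡⟨ cong (∑∑ ordered +_) (∑-swap vertices vertices ordered) ⟩
    ∑∑ ordered + ∑∑ (λ u v → ordered v u)             ≡⟨ sym (∑∑-+ ordered (λ u v → ordered v u)) ⟩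
    ∑∑ (λ u v → ordered u v + ordered v u)            ≡⟨ ∑-cong vertices (λ u → ∑-cong vertices (orient u)) ⟩
    ∑∑ (λ u v → rise u v + rise v u)                  ≡⟨ ∑∑-+ rise (λ u v → rise v u) ⟩
    ∑∑ rise + ∑∑ (λ u v → rise v u)                   ≡⟨ cong (∑∑ rise +_) (sym (∑-swap vertices vertices rise)) ⟩
    ∑∑ rise + ∑∑ rise                                 ∎
    where open ≡-Reasoning

  -- The split graph has twice the vertices and the same number of edges, so average degree 4k in G
  -- becomes the bound 2k per vertex from which peeling starts.
  dense-subgraph : ∀ k → 1 ≤ k → AvgDegreeAtLeast G (4 * k) →
                   Σ[ ys ∈ List V₂ ] Σ[ y ∈ V₂ ] y ∈ ys × Unique ys × (∀ {x} → x ∈ ys → k < deg ys x)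
  dense-subgraph k 1≤k (1≤n , avg) =
    peel k 1≤k _ all₂ (proj₂ (nonempty (subst (1 ≤_) (sym all₂-length) (≤-trans 1≤n (m≤m+n (n G) (n G)))))) all₂-unique
      (subst₂ _≤_ (trans (eq k (n G)) (cong (2 * k *_) (sym all₂-length))) (trans edges-rise (sym total-all₂)) avg)
    where
    nonempty : ∀ {m} → 1 ≤ m → Σ[ p ∈ ℕ ] m ≡ suc p
    nonempty (s≤s _) = _ , refl
    eq : ∀ k n → 4 * k * n ≡ 2 * k * (n + n)
    eq = solve-∀

-- Long cycles with a chord

module _ {A : Set} (default : A) where

  at : List A → ℕ → A
  at []       _       = default
  at (x ∷ xs) zero    = x
  at (x ∷ xs) (suc i) = at xs i

  at-∈ : ∀ {xs i} → i < length xs → at xs i ∈ xs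
  at-∈ {x ∷ xs} {zero}  _         = here refl
  at-∈ {x ∷ xs} {suc i} (s≤s i<l) = there (at-∈ i<l)

  at-injective : ∀ {xs i j} → Unique xs → i < length xs → j < length xs → at xs i ≡ at xs j → i ≡ j
  at-injective {x ∷ xs} {zero}  {zero}  _        _         _         _  = refl
  at-injective {x ∷ xs} {zero}  {suc j} (x∉ ∷ _) _         (s≤s j<l) eq = ⊥-elim (All.lookup x∉ (at-∈ j<l) eq)
  at-injective {x ∷ xs} {suc i} {zero}  (x∉ ∷ _) (s≤s i<l) _         eq = ⊥-elim (All.lookup x∉ (at-∈ i<l) (sym eq))
  at-injective {x ∷ xs} {suc i} {suc j} (_ ∷ u)  (s≤s i<l) (s≤s j<l) eq = cong suc (at-injective u i<l j<l eq)

  at-linked : ∀ {R : A → A → Set} {xs i} → Linked R xs → suc i < length xs → R (at xs i) (at xs (suc i))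
  at-linked {i = zero}  (r ∷ _) _         = r
  at-linked {i = suc i} (_ ∷ l) (s≤s i<l) = at-linked {i = i} l i<l
  at-linked [-] (s≤s ())

  at-length : ∀ as {z bs} → at (as ++ z ∷ bs) (length as) ≡ z
  at-length []       = refl
  at-length (_ ∷ as) = at-length as

-- Indexed by natural numbers to suit arithmetic on positions; only indices up to `N′` matter. The
-- last two fields keep the chord from being an edge of the cycle.
record ChordedCycle {A : Set} (R : A → A → Set) (P : A → Set) (N′ r′ : ℕ) : Set where
  field
    vertex      : ℕ → A
    satisfies   : ∀ {i} → i < suc N′ → P (vertex i)
    injective   : ∀ {i j} → i < suc N′ → j < suc N′ → vertex i ≡ vertex j → i ≡ j
    successive  : ∀ {i} → suc i < suc N′ → R (vertex i) (vertex (suc i))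
    closing     : R (vertex N′) (vertex 0)
    chord       : R (vertex 0) (vertex (suc r′))
    1≤r′        : 1 ≤ r′
    chord-inner : suc (suc r′) < suc N′

module LongPath {A : Set} (_≟ₐ_ : DecidableEquality A) (e : A → A → Bool)
  (e-sym : ∀ x y → e x y ≡ e y x) (e-irrefl : ∀ x → e x x ≡ false) where

  open Peeling e e-sym e-irrefl using (deg)

  R : A → A → Set
  R x y = T (e x y)

  R-sym : ∀ {x y} → R x y → R y x
  R-sym {x} {y} = subst T (e-sym x y)

  R-irrefl : ∀ {x} → ¬ R x x
  R-irrefl {x} = subst T (e-irrefl x)

  degree : A → List A → ℕ
  degree p xs = length (filterᵇ (e p) xs)

  degree-∷ : ∀ p x xs → degree p (x ∷ xs) ≤ suc (degree p xs)
  degree-∷ p x xs with e p x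
  ... | true  = ≤-refl
  ... | false = n≤1+n _

  -- The path grows at its head p. The number m is fuel: a path inside S cannot have more vertices
  -- than S, so the growth stops before m runs out.
  maximal-path : ∀ {S} m p xs → length S < m + length (p ∷ xs) → Linked R (p ∷ xs) → Unique (p ∷ xs) →
                 (∀ {x} → x ∈ p ∷ xs → x ∈ S) →
                 Σ[ p ∈ A ] Σ[ xs ∈ List A ] Linked R (p ∷ xs) × Unique (p ∷ xs) × p ∈ S × (∀ {y} → y ∈ S → R p y → y ∈ xs)
  maximal-path zero    p xs short l u sub = ⊥-elim (<-irrefl refl (<-≤-trans short (unique-⊆-length u sub)))
  maximal-path {S} (suc m) p xs short l u sub
    with Any.any? (λ y → T? (e p y) ×-dec ¬? (DecMembership._∈?_ _≟ₐ_ y (p ∷ xs))) S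
  ... | yes found with find found
  ...   | y , y∈S , r , y∉ =
    maximal-path m y (p ∷ xs) (subst (length S <_) (sym (+-suc m _)) short) (R-sym {p} r ∷ l) (All.¬Any⇒All¬ _ y∉ ∷ u)
      λ { (here refl) → y∈S ; (there x∈) → sub x∈ }
  maximal-path (suc m) p xs short l u sub | no none = p , xs , l , u , sub (here refl) , absorbed
    where
    absorbed : ∀ {y} → y ∈ _ → R p y → y ∈ xs
    absorbed {y} y∈S r with DecMembership._∈?_ _≟ₐ_ y (p ∷ xs)
    ... | yes (there y∈)  = y∈
    ... | yes (here refl) = ⊥-elim (R-irrefl {p} r)
    ... | no y∉           = ⊥-elim (none (lose y∈S (r , y∉)))

  next-neighbour : ∀ p zs {m} → suc m ≤ degree p zs →
                   Σ[ ms ∈ List A ] Σ[ y ∈ A ] Σ[ bs ∈ List A ] zs ≡ ms ++ y ∷ bs × R p y × m ≤ degree p bs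
  next-neighbour p (z ∷ zs) le with e p z in eq
  ... | true  = [] , z , zs , refl , subst T (sym eq) _ , s≤s⁻¹ le
  ... | false with next-neighbour p zs le
  ...   | ms , y , bs , refl , r , le′ = z ∷ ms , y , bs , refl , r , le′

  -- Two neighbours of p that are consecutive on the path close a cycle with p, so they lie at least q apart.
  Spread : ℕ → Set
  Spread q = ∀ p as x ms y bs → Linked R (p ∷ as ++ x ∷ ms ++ y ∷ bs) → Unique (p ∷ as ++ x ∷ ms ++ y ∷ bs) →
             R p x → R p y → q ≤ suc (length ms)

  -- Passes over j further neighbours of p beyond x, each at least q places after the one before.
  -- The list `as` collects what lies between p and the current neighbour.
  far-neighbour : ∀ {q} → Spread q → ∀ j p as x zs → Linked R (p ∷ as ++ x ∷ zs) → Unique (p ∷ as ++ x ∷ zs) → R p x →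
                  j ≤ degree p zs →
                  Σ[ ms ∈ List A ] Σ[ y ∈ A ] Σ[ bs ∈ List A ] x ∷ zs ≡ ms ++ y ∷ bs × R p y × j * q ≤ length ms
  far-neighbour spread zero    p as x zs l u r le = [] , x , zs , refl , r , z≤n
  far-neighbour {q} spread (suc j) p as x zs l u r le with next-neighbour p zs le
  ... | ms , y , bs , refl , r′ , le′
    with far-neighbour spread j p (as ++ x ∷ ms) y bs (subst (λ l → Linked R (p ∷ l)) assoc l)
           (subst (λ l → Unique (p ∷ l)) assoc u) r′ le′
    where
    assoc : as ++ x ∷ ms ++ y ∷ bs ≡ (as ++ x ∷ ms) ++ y ∷ bs
    assoc = sym (List.++-assoc as (x ∷ ms) (y ∷ bs))
  ...   | ns , z , os , eq , r″ , far =
    x ∷ ms ++ ns , z , os , cong (x ∷_) (trans (cong (ms ++_) eq) (sym (List.++-assoc ms ns (z ∷ os)))) , r″ ,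
    ≤-trans (+-mono-≤ (spread p as x ms y bs l u r r′) far) (≤-reflexive (cong suc (sym (List.length-++ ms))))

  -- The end p of a maximal path has at least k + 1 neighbours on it: first x, then y, and z after k
  -- - 1 more. The edge pz closes the cycle, py is the chord, and from x to z there are k gaps of at
  -- least q. As 2 ≤ k, z lies beyond y. The family `P` will be that of the layers.
  chorded-cycle : ∀ {I : Set} {P : I → A → Set} {q S s k} → Spread q → 1 ≤ q → 2 ≤ k → (∀ {p xs} → Linked R (p ∷ xs) → 1 ≤ length xs → Σ[ i ∈ I ] All (P i) (p ∷ xs)) →
                  s ∈ S → Unique S → (∀ {x} → x ∈ S → k < deg S x) →
                  Σ[ i ∈ I ] Σ[ N′ ∈ ℕ ] Σ[ r′ ∈ ℕ ] ChordedCycle R (P i) N′ r′ × suc (k * q) ≤ N′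
  chorded-cycle {I} {P} {q} {S} {s} {suc (suc j)} spread 1≤q (s≤s (s≤s z≤n)) layer s∈S uS deg>k
    with maximal-path (length S) s [] (m<m+n (length S) (s≤s z≤n)) [-] ([] ∷ []) (λ { (here refl) → s∈S })
  ... | p , xs , l , u , p∈S , absorbed = build xs l u many
    where
    many : suc (suc (suc j)) ≤ degree p xs
    many = ≤-trans (≤-trans (deg>k p∈S) (≤-reflexive (sym (length-filterᵇ (e p) S))))
      (unique-⊆-length (Unique.filter⁺ (T? ∘ e p) uS) λ y∈ → let y∈S , r = ∈-filter⁻ (T? ∘ e p) y∈ in ∈-filter⁺ (T? ∘ e p) (absorbed y∈S r) r)
    build : ∀ xs → Linked R (p ∷ xs) → Unique (p ∷ xs) → suc (suc (suc j)) ≤ degree p xs →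
            Σ[ i ∈ I ] Σ[ N′ ∈ ℕ ] Σ[ r′ ∈ ℕ ] ChordedCycle R (P i) N′ r′ × suc (suc (suc j) * q) ≤ N′
    build (x ∷ zs) l@(p~x ∷ _) u le with next-neighbour p zs (s≤s⁻¹ (≤-trans le (degree-∷ p x zs)))
    ...   | ms , y , bs , refl , p~y , le′
      with far-neighbour spread (suc j) p (x ∷ ms) y bs l u p~y le′
    ...     | ns , z , os , eq , p~z , far =
      -- With p at position 0 and x at 1, the position of y is `length ms` + 2 and that of z is
      -- `length (ms ++ ns)` + 2.
      proj₁ (layer l (s≤s z≤n)) , suc (suc (length (ms ++ ns))) , suc (length ms) , record
        { vertex      = c
        ; satisfies   = λ i< → All.lookup (proj₂ (layer l (s≤s z≤n))) (at-∈ p (<-≤-trans i< N≤))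
        ; injective   = λ i< j< → at-injective p u (<-≤-trans i< N≤) (<-≤-trans j< N≤)
        ; successive  = λ {i} i< → at-linked p {i = i} l (<-≤-trans i< N≤)
        ; closing     = R-sym {p} (subst (R p) (sym c-last) p~z)
        ; chord       = subst (R p) (sym (at-length p ms)) p~y
        ; 1≤r′        = s≤s z≤n
        ; chord-inner = s≤s (s≤s (s≤s (subst (length ms <_) (sym (List.length-++ ms)) (m<m+n (length ms) 1≤ns))))
        } , s≤s (≤-trans (+-mono-≤ (spread p [] x ms y bs l u p~x p~y) far) (≤-reflexive (cong suc (sym (List.length-++ ms)))))
      where
      c : ℕ → A
      c = at p (p ∷ x ∷ ms ++ y ∷ bs)
      split : ms ++ y ∷ bs ≡ (ms ++ ns) ++ z ∷ os
      split = trans (cong (ms ++_) eq) (sym (List.++-assoc ms ns (z ∷ os)))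
      c-last : c (suc (suc (length (ms ++ ns)))) ≡ z
      c-last = trans (cong (λ l → at p l (length (ms ++ ns))) split) (at-length p (ms ++ ns))
      1≤ns : 1 ≤ length ns
      1≤ns = ≤-trans 1≤q (≤-trans (m≤m+n q (j * q)) far)
      N≤ : suc (suc (suc (length (ms ++ ns)))) ≤ length (p ∷ x ∷ ms ++ y ∷ bs)
      N≤ = s≤s (s≤s (subst (length (ms ++ ns) <_) (sym (trans (cong length split) (List.length-++ (ms ++ ns)))) (m<m+n _ (s≤s z≤n))))

-- Closing a path through a common ancestor

unique-resp-⊇ : {A : Set} {xs ys : List A} → xs ⊆ ys → Unique ys → Unique xs
unique-resp-⊇ []         []       = []
unique-resp-⊇ (_ ∷ʳ τ)   (_ ∷ u)  = unique-resp-⊇ τ u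
unique-resp-⊇ (refl ∷ τ) (y∉ ∷ u) = All-resp-⊆ τ y∉ ∷ unique-resp-⊇ τ u

module _ {A : Set} {R : A → A → Set} where

  linked-suffix : ∀ as {zs} → Linked R (as ++ zs) → Linked R zs
  linked-suffix []            l       = l
  linked-suffix (_ ∷ [])      [-]     = []
  linked-suffix (_ ∷ [])      (_ ∷ l) = l
  linked-suffix (_ ∷ a ∷ as)  (_ ∷ l) = linked-suffix (a ∷ as) l

  linked-route : ∀ x ms {y bs} → Linked R (x ∷ ms ++ y ∷ bs) → Route R x (x ∷ ms ++ y ∷ []) y
  linked-route x []       (r ∷ _) = r ∷ [·]
  linked-route x (m ∷ ms) (r ∷ l) = r ∷ linked-route m ms l

  -- Jumps from p over `as` to x. When y is also adjacent to p, this path closes to a cycle on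
  -- `length ms` + 3 vertices.
  shortcut : ∀ {P : A → Set} p as x ms y bs → Linked R (p ∷ as ++ x ∷ ms ++ y ∷ bs) → Unique (p ∷ as ++ x ∷ ms ++ y ∷ bs) →
             All P (p ∷ as ++ x ∷ ms ++ y ∷ bs) → R p x → Path R P p y (suc (suc (length ms)))
  shortcut p as x ms y bs l u ps r = path (p ∷ x ∷ ms ++ y ∷ []) (r ∷ linked-route x ms (linked-suffix (p ∷ as) l))
    (unique-resp-⊇ kept u) (All-resp-⊆ kept ps)
    (cong (suc ∘ suc) (trans (List.length-++ ms) (+-comm (length ms) 1)))
    where
    kept : p ∷ x ∷ ms ++ y ∷ [] ⊆ p ∷ as ++ x ∷ ms ++ y ∷ bs
    kept = refl ∷ ++⁺ˡ as (refl ∷ ++⁺ ⊆-refl (refl ∷ minimum bs))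

map-path : {A B : Set} {R : A → A → Set} {Q : B → B → Set} {P : A → Set} {W : B → Set} (f : A → B) →
           (∀ {x y} → R x y → Q (f x) (f y)) → (∀ {x y} → P x → P y → f x ≡ f y → x ≡ y) → (∀ {x} → P x → W (f x)) →
           ∀ {x y ℓ} → Path R P x y ℓ → Path Q W (f x) (f y) ℓ
map-path f hom inj P⇒W (path xs p u as m) =
  path (map f xs) (route-map f (λ _ _ → hom) as p) (unique-map f inj as u) (All.map⁺ (All.map P⇒W as)) (trans (List.length-map f xs) m)

path⇒cycle : ∀ (G : Graph) {P u v m} → Path (Adj G) P u v m → 2 ≤ m → Adj G v u → HasCycle G (suc m)
path⇒cycle G (path _ [·]       un _ len) 2≤m e = s≤s 2≤m , _ , _ , len , un , route-closed [·] e
path⇒cycle G (path _ p@(_ ∷ _) un _ len) 2≤m e = s≤s 2≤m , _ , _ , len , un , route-closed p e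

module Climb (G : Graph) (F : Forest G) where
  open Forest F

  private
    V : Set
    V = Fin (n G)

  adj-sym : ∀ {u v} → Adj G u v → Adj G v u
  adj-sym {u} {v} = subst T (Graph.sym G u v)

  anc : ℕ → V → V
  anc zero    v = v
  anc (suc t) v = parent (anc t v)

  anc-level : ∀ t {v m} → level v ≡ t + m → level (anc t v) ≡ m
  anc-level zero    eq = eq
  anc-level (suc t) eq = parent-level (anc-level t (trans eq (sym (+-suc t _))))

  anc-adj : ∀ {t v} → t < level v → Adj G (anc t v) (anc (suc t) v)
  anc-adj {t} t<l with difference t<l
  ... | m , eq = parent-adj (anc-level t (trans (sym eq) (sym (+-suc t m))))

  anc-root : ∀ t {v} → t ≤ level v → root (anc t v) ≡ root v
  anc-root zero    _ = refl
  anc-root (suc t) t<l = trans (sym (root-adj (anc-adj t<l))) (anc-root t (<⇒≤ t<l))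

  anc-level≡root : ∀ {i v} → level v ≡ i → anc i v ≡ root v
  anc-level≡root {i} eq =
    trans (level-zero (anc-level i (trans eq (sym (+-identityʳ i))))) (anc-root i (≤-reflexive (sym eq)))

  anc-merge : ∀ k {t u v} → anc t u ≡ anc t v → anc (k + t) u ≡ anc (k + t) v
  anc-merge zero    eq = eq
  anc-merge (suc k) eq = cong parent (anc-merge k eq)

  -- The level of an ancestor of a vertex on level i determines how many steps away it is.
  anc-height : ∀ {i u v s t} → level u ≡ i → level v ≡ i → s ≤ i → t ≤ i → anc s u ≡ anc t v → s ≡ t
  anc-height {u = u} {v} {s} {t} lu lv s≤i t≤i eq with difference s≤i | difference t≤i
  ... | a , s+a≡i | b , t+b≡i = +-cancelʳ-≡ a s t (trans s+a≡i (trans (sym t+b≡i) (cong (t +_) (sym a≡b))))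
    where
    a≡b : a ≡ b
    a≡b = trans (sym (anc-level s (trans lu (sym s+a≡i)))) (trans (cong level eq) (anc-level t (trans lv (sym t+b≡i))))

  Above : V → ℕ → ℕ → V → Set
  Above v s b x = Σ[ t ∈ ℕ ] s ≤ t × t ≤ b × x ≡ anc t v

  climb : ∀ m {s b v i} → level v ≡ i → s + m ≡ b → b ≤ i → Path (Adj G) (Above v s b) (anc s v) (anc b v) m
  climb zero {s} lv eq b≤i with refl ← trans (sym (+-identityʳ s)) eq = trivial _ (s , ≤-refl , ≤-refl , refl)
  climb (suc m) {s} {b} {v} {i} lv eq b≤i =
    join (trivial {P = _≡ anc s v} (anc s v) refl) (anc-adj (<-≤-trans s<b (≤-trans b≤i (≤-reflexive (sym lv)))))
      (climb m lv (trans (sym (+-suc s m)) eq) b≤i)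
      (λ { refl (t , s<t , t≤b , eq) → <-irrefl (anc-height lv lv (<⇒≤ (<-≤-trans s<b b≤i)) (≤-trans t≤b b≤i) eq) s<t })
      (λ { refl → s , ≤-refl , <⇒≤ s<b , refl })
      (λ { (t , s<t , t≤b , eq) → t , <⇒≤ s<t , t≤b , eq })
    where
    s<b : s < b
    s<b = subst (s <_) eq (m<m+n s (s≤s z≤n))

  -- The cycle follows p from u to v, climbs from v to the common ancestor, and returns to u. Proper
  -- ancestors lie on levels below i, hence off p. The two chains do not meet earlier, since once
  -- merged they would still agree at height h.
  close : ∀ {u v i h ℓ} → level u ≡ i → level v ≡ i → suc h ≤ i → anc (suc h) u ≡ anc (suc h) v → anc h u ≢ anc h v →
          1 ≤ ℓ → Path (Adj G) (λ x → i ≤ level x) u v ℓ → HasCycle G (ℓ + 2 * suc h)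
  close {u} {v} {i} {h} {ℓ} lu lv h<i meet apart 1≤ℓ p = finish h refl
    where
    Outer : V → Set
    Outer x = i ≤ level x ⊎ Above v 1 (suc h) x
    low : ∀ {w a b x} → level w ≡ i → b ≤ i → Above w (suc a) b x → ¬ i ≤ level x
    low {w} lw b≤i (suc t , _ , t≤b , refl) i≤ with difference (≤-trans t≤b b≤i)
    ... | m , eq =
      <-irrefl refl (<-≤-trans (subst (m <_) eq (s≤s (m≤n+m m t)))
        (≤-trans i≤ (≤-reflexive (anc-level (suc t) (trans lw (sym eq))))))
    outer : Path (Adj G) Outer u (anc (suc h) v) (suc (ℓ + h))
    outer = join p (anc-adj {0} (subst (0 <_) (sym lv) (≤-trans (s≤s z≤n) h<i))) (climb h lv refl h<i)
      (λ i≤ above → low lv h<i above i≤) inj₁ inj₂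
    top : Adj G (anc (suc h) v) (anc h u)
    top = adj-sym (subst (Adj G (anc h u)) meet (anc-adj (≤-trans h<i (≤-reflexive (sym lu)))))
    -- If h = 0, the common ancestor is adjacent to u itself and no returning chain is left to
    -- append.
    finish : ∀ h′ → h ≡ h′ → HasCycle G (ℓ + 2 * suc h)
    finish zero refl = subst (HasCycle G) (eq ℓ) (path⇒cycle G outer (s≤s (≤-trans 1≤ℓ (m≤m+n ℓ 0))) top)
      where
      eq : ∀ ℓ → suc (suc (ℓ + 0)) ≡ ℓ + 2
      eq = solve-∀
    finish (suc h′) refl = subst (HasCycle G) (eq ℓ h′) (path⇒cycle G whole (s≤s (s≤s z≤n)) (adj-sym (anc-adj {0} (subst (0 <_) (sym lu) (≤-trans (s≤s z≤n) h<i)))))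
      where
      eq : ∀ ℓ h′ → suc (suc (suc (ℓ + suc h′) + h′)) ≡ ℓ + 2 * suc (suc h′)
      eq = solve-∀
      disjoint : ∀ {x} → Outer x → Above u 1 h x → ⊥
      disjoint (inj₁ i≤) above = low lu (<⇒≤ h<i) above i≤
      disjoint (inj₂ (t , _ , t≤1+h , refl)) (s , _ , s≤h , eq)
        with refl ← anc-height lv lu (≤-trans t≤1+h h<i) (≤-trans s≤h (<⇒≤ h<i)) eq with difference s≤h
      ... | k , t+k≡h = apart (subst (λ y → anc y u ≡ anc y v) (trans (+-comm k t) t+k≡h) (anc-merge k (sym eq)))
      whole : Path (Adj G) (λ _ → ⊤) u (anc 1 u) (suc (suc (ℓ + h) + h′))
      whole = join outer top (backwards adj-sym (climb h′ lu refl (<⇒≤ h<i))) disjoint _ _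

-- Colouring a layer by ancestors

module LayerCycles (G : Graph) (F : Forest G) {i N′ r′ : ℕ}
  (C : ChordedCycle (λ x y → T (SplitGraph.link G F x y)) (SplitGraph.InLayer G F i) N′ r′) where

  open Forest F
  open SplitGraph G F
  open Climb G F
  open ChordedCycle C

  N : ℕ
  N = suc N′

  base : ℕ → V
  base x = proj₁ (vertex x)

  lower : ℕ → Bool
  lower x = proj₂ (vertex x)

  Edge : ℕ → ℕ → Set
  Edge x y = T (link (vertex x) (vertex y))

  edge-sym : ∀ {x y} → Edge x y → Edge y x
  edge-sym {x} {y} = subst T (link-sym (vertex x) (vertex y))

  edge-adj : ∀ {x y} → Edge x y → Adj G (base x) (base y)
  edge-adj {x} {y} = link⇒adj {vertex x} {vertex y}

  lower-suc : ∀ {x} → suc x < N → lower (suc x) ≡ not (lower x)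
  lower-suc {x} x< = link-flips {vertex x} {vertex (suc x)} (successive x<)

  lower-2 : ∀ {x} → suc (suc x) < N → lower (suc (suc x)) ≡ lower x
  lower-2 {x} x< = trans (lower-suc x<) (trans (cong not (lower-suc (<⇒≤ x<))) (Bool.not-involutive (lower x)))

  lower-level : ∀ {x} → x < N → lower x ≡ true → level (base x) ≡ i
  lower-level {x} x< low with vertex x | satisfies x<
  lower-level x< refl | _ , true | lev = lev

  upper-level : ∀ {x} → x < N → lower x ≡ false → level (base x) ≡ suc i
  upper-level {x} x< up with vertex x | satisfies x<
  upper-level x< refl | _ , false | lev = lev

  base-injective : ∀ {x y} → x < N → y < N → base x ≡ base y → x ≡ y
  base-injective x< y< eq = injective x< y< (layer-injective {i} (satisfies x<) (satisfies y<) eq)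

  same-root : ∀ {x} → x < N → root (base x) ≡ root (base 0)
  same-root {zero}  _  = refl
  same-root {suc x} x< = trans (sym (root-adj (edge-adj {x} {suc x} (successive x<)))) (same-root (<⇒≤ x<))

  4≤N : 4 ≤ N
  4≤N = ≤-trans (s≤s (s≤s (s≤s 1≤r′))) chord-inner

  not-both : ∀ {x} → lower x ≡ true → lower x ≡ false → ⊥
  not-both low up with () ← trans (sym low) up

  -- The levels i and i + 1 alternate along the cycle, so exactly one of the positions 0 and 1 is on
  -- level i. It serves as the reference vertex.
  first-lower : Σ[ o ∈ ℕ ] o ≤ 1 × lower o ≡ true × (∀ {x} → x ≤ 1 → lower x ≡ true → x ≡ o)
  first-lower with lower 0 in eq
  ... | true  = 0 , z≤n , eq , only-0
    where
    only-0 : ∀ {x} → x ≤ 1 → lower x ≡ true → x ≡ 0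
    only-0 {zero}        _        _   = refl
    only-0 {suc zero}    _        low = ⊥-elim (not-both {1} low (trans (lower-suc (<⇒≤ (<⇒≤ 4≤N))) (cong not eq)))
    only-0 {suc (suc _)} (s≤s ())
  ... | false = 1 , ≤-refl , trans (lower-suc (<⇒≤ (<⇒≤ 4≤N))) (cong not eq) , only-1
    where
    only-1 : ∀ {x} → x ≤ 1 → lower x ≡ true → x ≡ 1
    only-1 {zero}        _        low = ⊥-elim (not-both {0} low eq)
    only-1 {suc zero}    _        _   = refl
    only-1 {suc (suc _)} (s≤s ())

  o : ℕ
  o = proj₁ first-lower

  o-lower : lower o ≡ true
  o-lower = proj₁ (proj₂ (proj₂ first-lower))

  3+o≤N : 3 + o ≤ N
  3+o≤N = ≤-trans (s≤s (s≤s (s≤s (proj₁ (proj₂ first-lower))))) 4≤N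

  o<N : o < N
  o<N = <⇒≤ (<⇒≤ 3+o≤N)

  Merged : ℕ → Set
  Merged t = ∀ {x} → x < N → lower x ≡ true → anc t (base x) ≡ anc t (base o)

  merged? : ∀ t → Dec (Merged t)
  merged? t = allUpTo? (λ x → (lower x Bool.≟ true) →-dec (anc t (base x) Fin.≟ anc t (base o))) N

  merged-i : Merged i
  merged-i x< low = trans (anc-level≡root (lower-level x< low))
    (trans (same-root x<) (trans (sym (same-root o<N)) (sym (anc-level≡root (lower-level o<N o-lower)))))

  ¬merged-0 : ¬ Merged 0
  ¬merged-0 merged =
    m≢1+n+m o {1} (sym (base-injective 3+o≤N o<N (merged 3+o≤N (trans (lower-2 3+o≤N) o-lower))))

  -- At height i all ancestors are the common root, while at height 0 the positions o and o + 2
  -- carry different vertices; the least merging height lies in between.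
  merging-height : Σ[ h ∈ ℕ ] suc h ≤ i × Merged (suc h) × ¬ Merged h
  merging-height with least merged? i merged-i
  ... | zero  , merged , _   , _   = ⊥-elim (¬merged-0 merged)
  ... | suc h , merged , h<i , min = h , h<i , merged , min ≤-refl

  h : ℕ
  h = proj₁ merging-height

  meets : ℕ → Bool
  meets x = does (anc h (base x) Fin.≟ anc h (base o))

  -- Vertices on level i + 1 all receive `false`. In a path of even length with differently coloured
  -- ends, the `true` end is on level i, and by parity so is the other.
  side : ℕ → Bool
  side x = lower x ∧ meets x

  open Theta Edge (λ {x} {y} → edge-sym {x} {y}) N′ r′ successive closing chord 1≤r′ chord-inner side
    using (Split; TwoPeriodic; theta; w≡χ)

  ∧-true : ∀ {a b} → a ∧ b ≡ true → a ≡ true × b ≡ true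
  ∧-true {true} {true} _ = refl , refl

  meets⁻ : ∀ {x} → meets x ≡ true → anc h (base x) ≡ anc h (base o)
  meets⁻ {x} eq with anc h (base x) Fin.≟ anc h (base o)
  ... | yes p = p

  -- Period 2 would carry the colour of o to every vertex on level i, and then all their ancestors
  -- would already agree at height h.
  not-two-periodic : ¬ TwoPeriodic
  not-two-periodic periodic = proj₂ (proj₂ (proj₂ merging-height)) λ {x} x< low →
    meets⁻ {x} (proj₂ (∧-true {lower x} (trans (sym (w≡χ x<)) (constant x x< low))))
    where
    side-o : side o ≡ true
    side-o = cong₂ _∧_ o-lower (dec-true (anc h (base o) Fin.≟ anc h (base o)) refl)
    constant : ∀ x → x < N → lower x ≡ true → side (x % N) ≡ true
    initial : ∀ x → x ≤ 1 → x < N → lower x ≡ true → side (x % N) ≡ true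
    initial x x≤1 x< low = trans (w≡χ x<) (trans (cong side (proj₂ (proj₂ (proj₂ first-lower)) x≤1 low)) side-o)
    constant zero          = initial 0 z≤n
    constant (suc zero)    = initial 1 ≤-refl
    constant (suc (suc x)) x< low =
      trans (cong (λ y → side (y % N)) (+-comm 2 x)) (trans (periodic x) (constant x (<⇒≤ (<⇒≤ x<)) (trans (sym (lower-2 x<)) low)))

  route-lower : ∀ {x y xs m} → Route Edge x xs y → length xs ≡ suc m → lower x ≡ alternate m (lower y)
  route-lower {m = zero}  [·]           _   = refl
  route-lower {m = zero}  (_ ∷ [·])     ()
  route-lower {m = zero}  (_ ∷ (_ ∷ _)) ()
  route-lower {m = suc m} (_∷_ {x} {z} e p) len =
    trans (link-flips {vertex z} {vertex x} (edge-sym {x} {z} e)) (cong not (route-lower p (suc-injective len)))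

  -- Both ends lie on level i, b by parity. Their ancestors agree at height h + 1 but not at height
  -- h, since only that of a is the ancestor of o.
  cycle-from : ∀ {a b} m → Path Edge (_< N) a b (2 * suc m) → side a ≡ true → side b ≢ true → HasCycle G (2 * suc m + 2 * suc h)
  cycle-from {a} {b} m p sa sb = close (lower-level a< la) (lower-level b< lb)
    (proj₁ (proj₂ merging-height))
    (trans (merged a< la) (sym (merged b< lb)))
    (λ eq → sb (cong₂ _∧_ lb (dec-true (_ Fin.≟ _) (trans (sym eq) (meets⁻ {a} (proj₂ (∧-true {lower a} sa)))))))
    (s≤s z≤n)
    (map-path base (λ {x} {y} → edge-adj {x} {y}) base-injective (λ x< → layer-≤ (satisfies x<)) p)
    where
    open Path p
    merged : Merged (suc h)
    merged = proj₁ (proj₂ (proj₂ merging-height))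
    a< : a < N
    a< = All.lookup inside (head∈ route)
    b< : b < N
    b< = All.lookup inside (last∈ route)
    la : lower a ≡ true
    la = proj₁ (∧-true sa)
    lb : lower b ≡ true
    lb = trans (sym (trans (route-lower route len) (alternate-even (suc m) (lower b)))) la

  split-cycle : ∀ m → Split (2 * suc m) → HasCycle G (2 * suc m + 2 * suc h)
  split-cycle m (a , b , p , a≢b) with side a Bool.≟ true | side b Bool.≟ true
  ... | yes sa | yes sb = ⊥-elim (a≢b (trans sa (sym sb)))
  ... | yes sa | no ¬sb = cycle-from m p sa ¬sb
  ... | no ¬sa | yes sb = cycle-from m (backwards (λ {x} {y} → edge-sym {x} {y}) p) sb ¬sa
  ... | no ¬sa | no ¬sb = ⊥-elim (a≢b (trans (Bool.¬-not ¬sa) (sym (Bool.¬-not ¬sb))))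

  cycle : ∀ m → 2 * suc m < N → HasCycle G (2 * suc m + 2 * suc h)
  cycle m m<N = [ split-cycle m , ⊥-elim ∘ not-two-periodic ]′ (theta (2 * suc m) (s≤s z≤n) m<N)

  -- The cycle also visits level i + 1, which the radius bounds, and h + 1 ≤ i. The extra level pays
  -- for the two edges of the shortest path that is closed up.
  height-radius : ∀ r → RadiusAtMost G r → suc (suc h) ≤ r
  height-radius r radius = ≤-trans (s≤s (proj₁ (proj₂ merging-height)))
    (subst (_≤ r) (upper-level 1+o<N (trans (lower-suc 1+o<N) (cong not o-lower))) (level-radius r radius (base (suc o))))
    where
    1+o<N : suc o < N
    1+o<N = <⇒≤ 3+o≤N

-- Girth and the count of lengths

girth-spread : ∀ (G : Graph) (F : Forest G) {g} → Girth G g →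
               LongPath.Spread (Product.≡-dec Fin._≟_ Bool._≟_) (SplitGraph.link G F) (SplitGraph.link-sym G F) (SplitGraph.link-irrefl G F) (g ∸ 2)
girth-spread G F {g} (_ , shortest) p as x ms y bs l u p~x p~y =
  -- The cycle through p, x, `ms` and y projects injectively to G, so g is at most `length ms` + 3.
  ∸-monoˡ-≤ 2 (shortest _ (path⇒cycle G
    (map-path {W = λ _ → ⊤} proj₁ (λ {x} {y} → link⇒adj {x} {y}) (layer-injective {proj₁ layer}) _
      (shortcut p as x ms y bs l u (linked-layer l (proj₂ layer)) p~x))
    (s≤s (s≤s z≤n)) (Climb.adj-sym G F (link⇒adj {p} {y} p~y))))
  where
  open SplitGraph G F
  layer : Σ[ i ∈ ℕ ] InLayer i p
  layer = link⇒layer {p} {x} p~x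

theorem1 : (k : ℕ) → 2 ≤ k → (G : Graph) → (g : ℕ) →
    Bipartite G → AvgDegreeAtLeast G (4 * k) → Girth G g →
    Σ ℕ λ ℓ → (Σ ℕ λ m → ℓ ≡ 2 * m)
      × (∀ i → i < (g / 2 ∸ 1) * k → HasCycle G (ℓ + 2 * i))
      × (∀ r → RadiusAtMost G r → ℓ ≤ 2 * r)
theorem1 k 2≤k G g bipartite average girth@((3≤g , _) , _)
  with SplitGraph.dense-subgraph G (forest G bipartite) k (<⇒≤ 2≤k) average
... | S , s , s∈S , unique , deg>k
  with LongPath.chorded-cycle (Product.≡-dec Fin._≟_ Bool._≟_) link link-sym link-irrefl
         (girth-spread G (forest G bipartite) girth) (∸-monoˡ-≤ 2 3≤g) 2≤k layer s∈S unique deg>k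
  where
  open SplitGraph G (forest G bipartite)
  layer : ∀ {p xs} → Linked (λ x y → T (link x y)) (p ∷ xs) → 1 ≤ length xs → Σ[ i ∈ ℕ ] All (InLayer i) (p ∷ xs)
  layer {p} l@(_∷_ {y = x} e _) _ = let i , at = link⇒layer {p} {x} e in i , linked-layer l at
... | i , N′ , r′ , C , long =
  -- The shortest cycle closes a path of 2 edges at height h + 1; the index j stands for a path of
  -- 2(j + 1) edges.
  2 * suc (suc h) , (suc (suc h) , refl) ,
  (λ j j< → subst (HasCycle G) (eq j h) (cycle j (s≤s (≤-trans (bound j j<) (<⇒≤ long))))) ,
  λ r radius → *-monoʳ-≤ 2 (height-radius r radius)
  where
  open LayerCycles G (forest G bipartite) C
  eq : ∀ j h → 2 * suc j + 2 * suc h ≡ 2 * suc (suc h) + 2 * j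
  eq = solve-∀
  bound : ∀ j → j < (g / 2 ∸ 1) * k → 2 * suc j ≤ k * (g ∸ 2)
  -- The rounding in `g / 2` is absorbed by `g / 2 * 2 ≤ g`.
  bound j j< = begin
    2 * suc j                ≤⟨ *-monoʳ-≤ 2 j< ⟩
    2 * ((g / 2 ∸ 1) * k)    ≡⟨ rearrange (g / 2 ∸ 1) k ⟩
    k * ((g / 2 ∸ 1) * 2)    ≡⟨ cong (k *_) (*-distribʳ-∸ 2 (g / 2) 1) ⟩
    k * (g / 2 * 2 ∸ 2)      ≤⟨ *-monoʳ-≤ k (∸-monoˡ-≤ 2 (m/n*n≤m g 2)) ⟩
    k * (g ∸ 2)              ∎
    where
    open ≤-Reasoning
    rearrange : ∀ a k → 2 * (a * k) ≡ k * (a * 2)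
    rearrange = solve-∀
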